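{- Let $\nu$ be a complex number that is not a negative integer, and let $D_{n,\nu}(q) = \prod_{k=1}^n [k+\nu]_q^{\lfloor n/k \rfloor}$. Then there exist polynomials $N_{n,\nu}(q)$, $n\ge1$, in $q$, $q^\nu$ and $[\nu]_q$ with nonnegative integer coefficients such that, as formal power series in $z$, both \[ \frac{J_{\nu+1}((1-q)z;q^{ -1})}{J_\nu((1-q)z;q^{ -1})} = - \sum_{n=1}^{\infty} \frac{N_{n,\nu}(q)}{D_{n,\nu}(q)} q^{(\nu+1)n} z^{2n-1} \] and \[ \frac{J_{\nu+1}((1-q)q^{1/2}z;q)}{J_\nu((1-q)z;q)} = q^{(\nu-1)/2} \sum_{n\ge1}\frac{N_{n,\nu}(q)}{D_{n,\nu}(q)} q^n z^{2n-1} \] hold.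
   Context: Notation: $(a;p)_n=(1-a)(1-ap)\cdots(1-ap^{n-1})$, $(a;p)_\infty=\prod_{i\ge0}(1-ap^i)$, and $[x]_q=(1-q^x)/(1-q)$. The Hahn–Exton $q$-Bessel function with base $p$ is $J_\nu(w;p)=\frac{(p^{\nu+1};p)_\infty w^\nu}{(p;p)_\infty}\Phi_\nu(w;p)$, where $\Phi_\nu(w;p)=\sum_{n\ge0}\frac{(-1)^n p^{\binom n2}(p w^2)^n}{(p;p)_n(p^{\nu+1};p)_n}$. Thus $\frac{J_{\nu+1}(w;p)}{J_\nu(w;p)}=\frac{w}{1-p^{\nu+1}}\frac{\Phi_{\nu+1}(w;p)}{\Phi_\nu(w;p)}$ (for $p=q^{ -1}$ understood as this formal power series in $w$), and $\frac{J_{\nu+1}(q^{1/2}w;q)}{J_\nu(w;q)}=\frac{q^{(\nu+1)/2}w}{1-q^{\nu+1}}\frac{\Phi_{\nu+1}(q^{1/2}w;q)}{\Phi_\nu(w;q)}$. -}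

module Defs where

open import Level using (_⊔_)
open import Data.Nat as ℕ using (ℕ; zero; suc; _∸_; _≤ᵇ_; _≤_)
open import Data.Nat.DivMod using (_/_)
open import Data.Nat.Combinatorics using (_C_)
open import Data.Bool using (if_then_else_)
open import Data.List using (List; []; _∷_)
open import Data.Product using (_×_; _,_)
open import Relation.Nullary using (¬_)
open import Algebra.Bundles using (CommutativeRing)

-- Fields: a commutative ring with 1 ≉ 0 and an inverse for every
-- nonzero element (the value of _⁻¹ at 0 is irrelevant).

record Field (c ℓ : Level.Level) : Set (Level.suc (c ⊔ ℓ)) where
  field
    commutativeRing : CommutativeRing c ℓ
  open CommutativeRing commutativeRing public
  field
    _⁻¹      : Carrier → Carrier
    1≉0      : ¬ (1# ≈ 0#)
    inverseʳ : ∀ x → ¬ (x ≈ 0#) → (x * (x ⁻¹)) ≈ 1#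

-- Polynomials in three variables with nonnegative integer coefficients:
-- a list of monomials  c · X^i · Y^j · Z^k  given as (c , i , j , k).

Poly3 : Set
Poly3 = List (ℕ × ℕ × ℕ × ℕ)

module OverField {c ℓ} (F : Field c ℓ) where
  open Field F using (Carrier; _≈_; _+_; _*_; -_; _-_; 0#; 1#; _⁻¹)

  pow : Carrier → ℕ → Carrier
  pow x zero    = 1#
  pow x (suc n) = x * pow x n

  fromℕ : ℕ → Carrier
  fromℕ zero    = 0#
  fromℕ (suc n) = 1# + fromℕ n

  sumTo : ℕ → (ℕ → Carrier) → Carrier
  sumTo zero    f = 0#
  sumTo (suc n) f = sumTo n f + f n

  prodTo : ℕ → (ℕ → Carrier) → Carrier
  prodTo zero    f = 1#
  prodTo (suc n) f = prodTo n f * f n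

  qPoch : Carrier → Carrier → ℕ → Carrier
  qPoch a p n = prodTo n (λ i → 1# - a * pow p i)

  eval3 : Poly3 → Carrier → Carrier → Carrier → Carrier
  eval3 []                      x y w = 0#
  eval3 ((c₀ , i , j , k) ∷ ms) x y w =
    fromℕ c₀ * pow x i * pow y j * pow w k + eval3 ms x y w

  -- Formal power series in z: coefficient sequences.

  PS : Set c
  PS = ℕ → Carrier

  _≈PS_ : PS → PS → Set ℓ
  f ≈PS g = ∀ n → f n ≈ g n

  _⊛_ : PS → PS → PS
  (f ⊛ g) n = sumTo (suc n) (λ k → f k * g (n ∸ k))

  scalePS : Carrier → PS → PS
  scalePS a f n = a * f n

  timesZ : PS → PS
  timesZ f zero    = 0#
  timesZ f (suc n) = f n

  evenPS : (ℕ → Carrier) → PS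
  evenPS a zero          = a zero
  evenPS a (suc zero)    = 0#
  evenPS a (suc (suc m)) = evenPS (λ n → a (suc n)) m

  oddPS : (ℕ → Carrier) → PS
  oddPS a zero    = 0#
  oddPS a (suc m) = evenPS (λ n → a (suc n)) m

  -- multiplicative inverse of a power series g (meaningful when g 0 ≠ 0):
  -- invUpTo n m is the m-th coefficient of 1/g for m ≤ n.
  invUpTo : PS → ℕ → ℕ → Carrier
  invUpTo g zero    m = (g zero) ⁻¹
  invUpTo g (suc n) m =
    if m ≤ᵇ n then invUpTo g n m
    else - ((g zero) ⁻¹ *
            sumTo (suc n) (λ k → g (suc k) * invUpTo g n (n ∸ k)))

  invPS : PS → PS
  invPS g m = invUpTo g m m

  _⊘_ : PS → PS → PS
  f ⊘ g = f ⊛ invPS g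

  -- Φ(c z ; p) with parameter a = p^(ν+1):
  --   Σ_n (-1)^n p^(n choose 2) (p (c z)^2)^n / ((p;p)_n (a;p)_n)
  PhiPS : (a p c₀ : Carrier) → PS
  PhiPS a p c₀ = evenPS (λ n →
    pow (- 1#) n * pow p (n C 2) * pow (p * c₀ * c₀) n
      * (qPoch p p n * qPoch a p n) ⁻¹)

  -- q-data, with t playing the role of q^ν.

  qBracketShift : (q t : Carrier) → ℕ → Carrier
  qBracketShift q t k = (1# - pow q k * t) * (1# - q) ⁻¹

  qBracketν : (q t : Carrier) → Carrier
  qBracketν q t = (1# - t) * (1# - q) ⁻¹

  Dnν : (q t : Carrier) → ℕ → Carrier
  Dnν q t n = prodTo n (λ i → pow (qBracketShift q t (suc i)) (n / suc i))

  Nnν : (ℕ → Poly3) → (q t : Carrier) → ℕ → Carrier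
  Nnν N q t n = eval3 (N n) q t (qBracketν q t)

  -- J_{ν+1}((1-q)z; q⁻¹) / J_ν((1-q)z; q⁻¹)
  --   = w/(1-p^(ν+1)) Φ_{ν+1}(w;p)/Φ_ν(w;p),  p = q⁻¹, w = (1-q)z,
  -- with p^(ν+1) = q⁻¹ t⁻¹ and p^(ν+2) = q⁻¹ q⁻¹ t⁻¹.
  JRatioInv : (q t : Carrier) → PS
  JRatioInv q t =
    let p  = q ⁻¹
        a₁ = p * t ⁻¹
        a₂ = p * p * t ⁻¹
    in scalePS ((1# - q) * (1# - a₁) ⁻¹) (timesZ (PhiPS a₂ p (1# - q)))
       ⊘ PhiPS a₁ p (1# - q)

  -- J_{ν+1}(q^{1/2} w; q) / J_ν(w; q)
  --   = q^((ν+1)/2) w/(1-q^(ν+1)) Φ_{ν+1}(q^{1/2} w;q)/Φ_ν(w;q),  w = (1-q)z,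
  -- with s = q^{1/2} and q^((ν+1)/2) = q · h where h = q^((ν-1)/2).
  JRatio : (q t s h : Carrier) → PS
  JRatio q t s h =
    scalePS (q * h * (1# - q) * (1# - q * t) ⁻¹)
            (timesZ (PhiPS (q * q * t) q (s * (1# - q))))
    ⊘ PhiPS (q * t) q (1# - q)

module Submission where

-- Put φ(v) = Φ_ν for v = z² and let φ_q be its dilation v ↦ qv. In both bases
-- the second-order q-difference equation of Φ_ν takes the form
--   φ − (1+t) φ_q + t φ_qq + κ v φ_q = 0
-- with κ = q(1−q)² in base q and κ = qt(1−q)² in base q⁻¹, so that r = φ_q / φ
-- solves a q-Riccati equation. Since φ_q − φ is a multiple of v Φ_{ν+1}, the
-- series r − 1 is, up to a monomial factor, the quotient of Bessel functions.
-- Comparing coefficients in the Riccati equation, C_n = N_n / D_n satisfies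
--   [1+ν] C_1 = 1,   [n+ν] C_n = C_1 C_{n-1} + t Σ_{k=2}^{n-1} q^k C_k C_{n-k},
-- and D_n / ([n+ν] D_k D_{n-k}) is a product of brackets with nonnegative
-- exponents because ⌊k/i⌋ + ⌊(n−k)/i⌋ ≤ ⌊n/i⌋. Hence N_n has nonnegative
-- coefficients.

-- The polynomials have to be fixed before the field, q and t are known. The numerators are
-- therefore built as syntax, and every division in the recurrence is carried out beforehand on the
-- exponents of the brackets. One sequence serves both bases because κ only sets the scale of v: the
-- series with coefficients C_n x^n satisfies the Riccati recurrence with κ = x (1 - q)², and x = q
-- or x = q t gives the two cases. The quotient φ_q / φ is never formed. Instead r is defined from
-- the C_n as a series with constant term 1, and the defect δ = r φ - φ_q is shown to vanish
-- coefficient by coefficient; this replaces both the inversion of φ and a uniqueness theorem for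
-- the Riccati equation.

open import Defs
open import Level using (0ℓ)
open import Algebra.Bundles using (CommutativeRing)
open import Algebra.Solver.Ring.AlmostCommutativeRing
  using (fromCommutativeRing; _-Raw-AlmostCommutative⟶_)
import Algebra.Solver.Ring
import Algebra.Properties.Ring
import Algebra.Properties.Semiring.Mult.TCOptimised
open import Data.Bool using (true; false)
open import Data.Bool.Properties using (T-≡)
open import Data.Empty using (⊥-elim)
open import Data.Integer as ℤ using (ℤ; +_; -[1+_])
import Data.Integer.Properties as ℤ
open import Data.List using ([]; _∷_; _++_; map)
open import Data.Maybe using (Maybe; just; nothing)
open import Data.Nat as ℕ using (ℕ; zero; suc; _∸_; _≤ᵇ_; s≤s)
open import Data.Nat.Combinatorics using (_C_; nCk+nC[k+1]≡[n+1]C[k+1]; nC1≡n)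
open import Data.Nat.DivMod using (_/_; m/n*n≤m; m*n/n≡m; /-monoˡ-≤; m<n⇒m/n≡0; n/n≡1)
open import Data.Nat.Induction using (<-rec)
import Data.Nat.Properties as ℕ
open import Data.Product using (Σ; _×_; _,_)
open import Data.Sum using (inj₁; inj₂)
open import Function using (_∘_)
open import Function.Bundles using (Equivalence)
import Relation.Binary.PropositionalEquality as ≡
open ≡ using (_≡_)
open import Relation.Nullary using (¬_; yes; no)

-- Normalisation of ring identities over integer coefficients.

-- The coefficients are integers rather than ring elements so that the solver
-- can decide when they cancel.
module IntegerSolver {c ℓ} (R : CommutativeRing c ℓ) where
  open CommutativeRing R
  open Algebra.Properties.Ring ring
  open Algebra.Properties.Semiring.Mult.TCOptimised semiring renaming (_×_ to _×ℕ_)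
  open import Relation.Binary.Reasoning.Setoid setoid

  -- The optimised multiple sends 0 and 1 to `0#` and `1#` by computation, so `con (+ 0)` and
  -- `con (+ 1)` are the ring constants themselves and solver calls can end in `refl`.
  ⟦_⟧ℤ : ℤ → Carrier
  ⟦ + n ⟧ℤ = n ×ℕ 1#
  ⟦ -[1+ n ] ⟧ℤ = - (suc n ×ℕ 1#)

  ⊖-homo : ∀ m n → ⟦ m ℤ.⊖ n ⟧ℤ ≈ m ×ℕ 1# - n ×ℕ 1#
  ⊖-homo m zero = sym (trans (+-congˡ -0#≈0#) (+-identityʳ _))
  ⊖-homo zero (suc n) = sym (+-identityˡ _)
  ⊖-homo (suc m) (suc n) = begin
    ⟦ suc m ℤ.⊖ suc n ⟧ℤ ≡⟨ ≡.cong ⟦_⟧ℤ (ℤ.[1+m]⊖[1+n]≡m⊖n m n) ⟩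
    ⟦ m ℤ.⊖ n ⟧ℤ ≈⟨ ⊖-homo m n ⟩
    -- Insert 0 = 1 - 1, so that one unit can join each of the two multiples.
    m ×ℕ 1# - n ×ℕ 1# ≈⟨ +-congʳ (+-identityʳ _) ⟨
    m ×ℕ 1# + 0# - n ×ℕ 1# ≈⟨ +-congʳ (+-congˡ (-‿inverseʳ 1#)) ⟨
    m ×ℕ 1# + (1# - 1#) - n ×ℕ 1# ≈⟨ +-congʳ (+-assoc _ _ _) ⟨
    m ×ℕ 1# + 1# - 1# - n ×ℕ 1# ≈⟨ +-congʳ (+-congʳ (+-comm _ _)) ⟩
    1# + m ×ℕ 1# - 1# - n ×ℕ 1# ≈⟨ +-assoc _ _ _ ⟩
    (1# + m ×ℕ 1#) + (- 1# - n ×ℕ 1#) ≈⟨ +-congˡ (-‿+-comm _ _) ⟩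
    (1# + m ×ℕ 1#) - (1# + n ×ℕ 1#) ≈⟨ +-cong (1+× m 1#) (-‿cong (1+× n 1#)) ⟨
    suc m ×ℕ 1# - suc n ×ℕ 1# ∎

  neg-homo : ∀ i → ⟦ ℤ.- i ⟧ℤ ≈ - ⟦ i ⟧ℤ
  neg-homo (+ zero) = sym -0#≈0#
  neg-homo (+ suc n) = refl
  neg-homo -[1+ n ] = sym (-‿involutive _)

  +-homo : ∀ i j → ⟦ i ℤ.+ j ⟧ℤ ≈ ⟦ i ⟧ℤ + ⟦ j ⟧ℤ
  +-homo (+ m) (+ n) = ×-homo-+ 1# m n
  +-homo (+ m) -[1+ n ] = ⊖-homo m (suc n)
  +-homo -[1+ m ] (+ n) = trans (⊖-homo n (suc m)) (+-comm _ _)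
  +-homo -[1+ m ] -[1+ n ] = begin
    - (suc (suc (m ℕ.+ n)) ×ℕ 1#) ≡⟨ ≡.cong (λ k → - (k ×ℕ 1#)) (ℕ.+-suc (suc m) n) ⟨
    - ((suc m ℕ.+ suc n) ×ℕ 1#) ≈⟨ -‿cong (×-homo-+ 1# (suc m) (suc n)) ⟩
    - (suc m ×ℕ 1# + suc n ×ℕ 1#) ≈⟨ -‿+-comm _ _ ⟨
    - (suc m ×ℕ 1#) - suc n ×ℕ 1# ∎

  *-homo : ∀ i j → ⟦ i ℤ.* j ⟧ℤ ≈ ⟦ i ⟧ℤ * ⟦ j ⟧ℤ
  *-homo (+ m) (+ n) = trans (reflexive (≡.cong ⟦_⟧ℤ (≡.sym (ℤ.pos-* m n)))) (×1-homo-* m n)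
  *-homo (+ m) -[1+ n ] = begin
    ⟦ + m ℤ.* -[1+ n ] ⟧ℤ ≡⟨ ≡.cong ⟦_⟧ℤ (ℤ.neg-distribʳ-* (+ m) (+ suc n)) ⟨
    ⟦ ℤ.- (+ m ℤ.* + suc n) ⟧ℤ ≈⟨ neg-homo (+ m ℤ.* + suc n) ⟩
    - ⟦ + m ℤ.* + suc n ⟧ℤ ≈⟨ -‿cong (*-homo (+ m) (+ suc n)) ⟩
    - (m ×ℕ 1# * suc n ×ℕ 1#) ≈⟨ -‿distribʳ-* _ _ ⟩
    m ×ℕ 1# * - (suc n ×ℕ 1#) ∎
  *-homo -[1+ m ] (+ n) = begin
    ⟦ -[1+ m ] ℤ.* + n ⟧ℤ ≡⟨ ≡.cong ⟦_⟧ℤ (ℤ.neg-distribˡ-* (+ suc m) (+ n)) ⟨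
    ⟦ ℤ.- (+ suc m ℤ.* + n) ⟧ℤ ≈⟨ neg-homo (+ suc m ℤ.* + n) ⟩
    - ⟦ + suc m ℤ.* + n ⟧ℤ ≈⟨ -‿cong (*-homo (+ suc m) (+ n)) ⟩
    - (suc m ×ℕ 1# * n ×ℕ 1#) ≈⟨ -‿distribˡ-* _ _ ⟩
    - (suc m ×ℕ 1#) * n ×ℕ 1# ∎
  *-homo -[1+ m ] -[1+ n ] = begin
    (suc m ℕ.* suc n) ×ℕ 1# ≈⟨ ×1-homo-* (suc m) (suc n) ⟩
    suc m ×ℕ 1# * suc n ×ℕ 1# ≈⟨ -‿involutive _ ⟨
    - - (suc m ×ℕ 1# * suc n ×ℕ 1#) ≈⟨ -‿cong (-‿distribʳ-* _ _) ⟩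
    - (suc m ×ℕ 1# * - (suc n ×ℕ 1#)) ≈⟨ -‿distribˡ-* _ _ ⟩
    - (suc m ×ℕ 1#) * - (suc n ×ℕ 1#) ∎

  morphism : ℤ.+-*-rawRing -Raw-AlmostCommutative⟶ fromCommutativeRing R
  morphism = record
    { ⟦_⟧ = ⟦_⟧ℤ
    ; +-homo = +-homo
    ; *-homo = *-homo
    ; -‿homo = neg-homo
    ; 0-homo = refl
    ; 1-homo = refl
    }

  private
    -- Distinct integers may still agree in R, for instance in positive characteristic, so
    -- inequality yields no verdict.
    weak≟ : ∀ i j → Maybe (⟦ i ⟧ℤ ≈ ⟦ j ⟧ℤ)
    weak≟ i j with i ℤ.≟ j
    ... | yes i≡j = just (reflexive (≡.cong ⟦_⟧ℤ i≡j))
    ... | no  _   = nothing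

  open Algebra.Solver.Ring ℤ.+-*-rawRing (fromCommutativeRing R) morphism weak≟ public

-- The ring of formal power series, and substitution of z² for the variable.

module PowerSeries {c ℓ} (F : Field c ℓ) where
  open Field F renaming (zero to *-zero)
  open OverField F
  open IntegerSolver commutativeRing using (solve; _:=_; con; _:+_; _:*_; _:-_; :-_)
  open import Relation.Binary.Reasoning.Setoid setoid

  sumTo-cong : ∀ n {f g : ℕ → Carrier} → (∀ i → i ℕ.< n → f i ≈ g i) → sumTo n f ≈ sumTo n g
  sumTo-cong zero    h = refl
  sumTo-cong (suc n) h = +-cong (sumTo-cong n (λ i i<n → h i (ℕ.m<n⇒m<1+n i<n))) (h n ℕ.≤-refl)

  sumTo-0 : ∀ n {f : ℕ → Carrier} → (∀ i → i ℕ.< n → f i ≈ 0#) → sumTo n f ≈ 0#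
  sumTo-0 zero    h = refl
  sumTo-0 (suc n) h =
    trans (+-cong (sumTo-0 n (λ i i<n → h i (ℕ.m<n⇒m<1+n i<n))) (h n ℕ.≤-refl)) (+-identityʳ 0#)

  sumTo-front : ∀ n (f : ℕ → Carrier) → sumTo (suc n) f ≈ f 0 + sumTo n (f ∘ suc)
  sumTo-front zero    f = +-comm _ _
  sumTo-front (suc n) f = trans (+-congʳ (sumTo-front n f)) (+-assoc _ _ _)

  sumTo-+ : ∀ n (f g : ℕ → Carrier) → sumTo n (λ i → f i + g i) ≈ sumTo n f + sumTo n g
  sumTo-+ zero    f g = sym (+-identityʳ 0#)
  sumTo-+ (suc n) f g = trans (+-congʳ (sumTo-+ n f g))
    (solve 4 (λ a b x y → (a :+ b) :+ (x :+ y) := (a :+ x) :+ (b :+ y)) refl _ _ _ _)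

  sumTo-*ˡ : ∀ n a (f : ℕ → Carrier) → sumTo n (λ i → a * f i) ≈ a * sumTo n f
  sumTo-*ˡ zero    a f = sym (zeroʳ a)
  sumTo-*ˡ (suc n) a f = trans (+-congʳ (sumTo-*ˡ n a f)) (sym (distribˡ _ _ _))

  ⊛-zero : ∀ f g → (f ⊛ g) 0 ≈ f 0 * g 0
  ⊛-zero f g = +-identityˡ _

  ⊛-suc : ∀ f g n → (f ⊛ g) (suc n) ≈ f 0 * g (suc n) + ((f ∘ suc) ⊛ g) n
  ⊛-suc f g n = sumTo-front (suc n) _

  ⊛-suc′ : ∀ f g n → (f ⊛ g) (suc n) ≈ (f ⊛ (g ∘ suc)) n + f (suc n) * g 0
  ⊛-suc′ f g n = +-cong
    (sumTo-cong (suc n) λ { i (s≤s i≤n) → *-congˡ (reflexive (≡.cong g (ℕ.+-∸-assoc 1 i≤n))) })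
    (*-congˡ (reflexive (≡.cong g (ℕ.n∸n≡0 (suc n)))))

  ⊛-cong : ∀ {f f′ g g′} → f ≈PS f′ → g ≈PS g′ → (f ⊛ g) ≈PS (f′ ⊛ g′)
  ⊛-cong p q n = sumTo-cong (suc n) λ i _ → *-cong (p i) (q (n ∸ i))

  -- Peeling the first term from one product and the last term from the other leaves the same
  -- shorter convolution, with f replaced by its tail.
  ⊛-comm : ∀ f g → (f ⊛ g) ≈PS (g ⊛ f)
  ⊛-comm f g zero    = +-congˡ (*-comm _ _)
  ⊛-comm f g (suc n) = begin
    (f ⊛ g) (suc n)                          ≈⟨ ⊛-suc f g n ⟩
    f 0 * g (suc n) + ((f ∘ suc) ⊛ g) n      ≈⟨ +-cong (*-comm _ _) (⊛-comm (f ∘ suc) g n) ⟩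
    g (suc n) * f 0 + (g ⊛ (f ∘ suc)) n      ≈⟨ +-comm _ _ ⟩
    (g ⊛ (f ∘ suc)) n + g (suc n) * f 0      ≈⟨ ⊛-suc′ g f n ⟨
    (g ⊛ f) (suc n)                          ∎

  infixl 6 _⊕_
  _⊕_ : PS → PS → PS
  (f ⊕ g) n = f n + g n

  ⊛-distribʳ : ∀ h f g → ((f ⊕ g) ⊛ h) ≈PS ((f ⊛ h) ⊕ (g ⊛ h))
  ⊛-distribʳ h f g n =
    trans (sumTo-cong (suc n) (λ i _ → distribʳ _ _ _)) (sumTo-+ (suc n) _ _)

  ⊛-distribˡ : ∀ h f g → (h ⊛ (f ⊕ g)) ≈PS ((h ⊛ f) ⊕ (h ⊛ g))
  ⊛-distribˡ h f g n =
    trans (sumTo-cong (suc n) (λ i _ → distribˡ _ _ _)) (sumTo-+ (suc n) _ _)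

  ⊛-scaleˡ : ∀ a f g → (scalePS a f ⊛ g) ≈PS scalePS a (f ⊛ g)
  ⊛-scaleˡ a f g n =
    trans (sumTo-cong (suc n) (λ i _ → *-assoc _ _ _)) (sumTo-*ˡ (suc n) a _)

  -- Dropping the constant term obeys a Leibniz rule: the tail of f g is f_0 times the tail of g,
  -- plus the tail of f times g. Induction on the degree then applies to the tail of f.
  ⊛-assoc : ∀ f g h → ((f ⊛ g) ⊛ h) ≈PS (f ⊛ (g ⊛ h))
  ⊛-assoc f g h zero    = solve 3 (λ a b c →
    con (+ 0) :+ (con (+ 0) :+ a :* b) :* c := con (+ 0) :+ a :* (con (+ 0) :+ b :* c)) refl _ _ _
  ⊛-assoc f g h (suc n) = begin
    ((f ⊛ g) ⊛ h) (suc n)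
      ≈⟨ ⊛-suc (f ⊛ g) h n ⟩
    (f ⊛ g) 0 * h (suc n) + (((f ⊛ g) ∘ suc) ⊛ h) n
      ≈⟨ +-cong (*-congʳ (⊛-zero f g)) (⊛-cong {g = h} (⊛-suc f g) (λ _ → refl) n) ⟩
    f 0 * g 0 * h (suc n) + ((scalePS (f 0) (g ∘ suc) ⊕ ((f ∘ suc) ⊛ g)) ⊛ h) n
      ≈⟨ +-congˡ (⊛-distribʳ h (scalePS (f 0) (g ∘ suc)) ((f ∘ suc) ⊛ g) n) ⟩
    f 0 * g 0 * h (suc n) + ((scalePS (f 0) (g ∘ suc) ⊛ h) n + (((f ∘ suc) ⊛ g) ⊛ h) n)
      ≈⟨ +-congˡ (+-cong (⊛-scaleˡ (f 0) (g ∘ suc) h n) (⊛-assoc (f ∘ suc) g h n)) ⟩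
    f 0 * g 0 * h (suc n) + (f 0 * ((g ∘ suc) ⊛ h) n + ((f ∘ suc) ⊛ (g ⊛ h)) n)
      ≈⟨ solve 5 (λ a b c x y → a :* b :* c :+ (a :* x :+ y) := a :* (b :* c :+ x) :+ y) refl _ _ _ _ _ ⟩
    f 0 * (g 0 * h (suc n) + ((g ∘ suc) ⊛ h) n) + ((f ∘ suc) ⊛ (g ⊛ h)) n
      ≈⟨ +-congʳ (*-congˡ (⊛-suc g h n)) ⟨
    f 0 * (g ⊛ h) (suc n) + ((f ∘ suc) ⊛ (g ⊛ h)) n
      ≈⟨ ⊛-suc f (g ⊛ h) n ⟨
    (f ⊛ (g ⊛ h)) (suc n) ∎

  constPS : Carrier → PS
  constPS a zero    = a
  constPS a (suc n) = 0#

  ⊛-constˡ : ∀ a f → (constPS a ⊛ f) ≈PS scalePS a f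
  ⊛-constˡ a f zero    = ⊛-zero (constPS a) f
  ⊛-constˡ a f (suc n) = begin
    (constPS a ⊛ f) (suc n)                       ≈⟨ ⊛-suc (constPS a) f n ⟩
    a * f (suc n) + ((λ _ → 0#) ⊛ f) n            ≈⟨ +-congˡ (sumTo-0 (suc n) λ _ _ → zeroˡ _) ⟩
    a * f (suc n) + 0#                            ≈⟨ +-identityʳ _ ⟩
    a * f (suc n)                                 ∎

  -- Bundled so that an identity proved in an arbitrary commutative ring, such as `riccatiDefect`,
  -- can be read for series.
  powerSeriesRing : CommutativeRing c ℓ
  powerSeriesRing = record
    { Carrier = PS
    ; _≈_ = _≈PS_
    ; _+_ = _⊕_
    ; _*_ = _⊛_
    ; -_ = λ f n → - f n
    ; 0# = λ _ → 0#
    ; 1# = constPS 1#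
    ; isCommutativeRing = record
      { isRing = record
        { +-isAbelianGroup = record
          { isGroup = record
            { isMonoid = record
              { isSemigroup = record
                { isMagma = record
                  { isEquivalence = record
                    { refl = λ _ → refl
                    ; sym = λ p n → sym (p n)
                    ; trans = λ p q n → trans (p n) (q n)
                    }
                  ; ∙-cong = λ p q n → +-cong (p n) (q n)
                  }
                ; assoc = λ f g h n → +-assoc _ _ _
                }
              ; identity = (λ f n → +-identityˡ _) , (λ f n → +-identityʳ _)
              }
            ; inverse = (λ f n → -‿inverseˡ _) , (λ f n → -‿inverseʳ _)
            ; ⁻¹-cong = λ p n → -‿cong (p n)
            }
          ; comm = λ f g n → +-comm _ _
          }
        ; *-cong = ⊛-cong
        ; *-assoc = ⊛-assoc
        ; *-identity = ⊛-identityˡ , (λ f n → trans (⊛-comm f (constPS 1#) n) (⊛-identityˡ f n))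
        ; distrib = ⊛-distribˡ , ⊛-distribʳ
        }
      ; *-comm = ⊛-comm
      }
    }
    where
    ⊛-identityˡ : ∀ f → (constPS 1# ⊛ f) ≈PS f
    ⊛-identityˡ f n = trans (⊛-constˡ 1# f n) (*-identityˡ _)

  -- The bound in `invUpTo` only drives the recursion; once it no longer matters, `invPS` obeys the
  -- usual recurrence for a reciprocal series.
  invUpTo-stable : ∀ g {m n} → m ℕ.≤ n → invUpTo g n m ≡ invPS g m
  invUpTo-stable g {m} {zero} ℕ.z≤n = ≡.refl
  invUpTo-stable g {m} {suc n} m≤1+n with ℕ.m≤n⇒m<n∨m≡n m≤1+n
  ... | inj₂ ≡.refl = ≡.refl
  ... | inj₁ (s≤s m≤n) rewrite Equivalence.to T-≡ (ℕ.≤⇒≤ᵇ m≤n) = invUpTo-stable g m≤n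

  invPS-suc : ∀ g n → invPS g (suc n) ≈ - (g 0 ⁻¹ * ((g ∘ suc) ⊛ invPS g) n)
  invPS-suc g n with suc n ≤ᵇ n in eq
  ... | true  = ⊥-elim (ℕ.<-irrefl ≡.refl (ℕ.≤ᵇ⇒≤ (suc n) n (Equivalence.from T-≡ eq)))
  ... | false = -‿cong (*-congˡ (sumTo-cong (suc n) λ k _ →
                  *-congˡ (reflexive (invUpTo-stable g (ℕ.m∸n≤m n k)))))

  ⊛-inverseʳ : ∀ g → ¬ (g 0 ≈ 0#) → (g ⊛ invPS g) ≈PS constPS 1#
  ⊛-inverseʳ g g₀≉0 zero    = trans (⊛-zero g (invPS g)) (inverseʳ _ g₀≉0)
  ⊛-inverseʳ g g₀≉0 (suc n) = begin
    (g ⊛ invPS g) (suc n)                    ≈⟨ ⊛-suc g (invPS g) n ⟩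
    g 0 * invPS g (suc n) + S                ≈⟨ +-congʳ (*-congˡ (invPS-suc g n)) ⟩
    g 0 * - (g 0 ⁻¹ * S) + S                 ≈⟨ solve 3 (λ a b s → a :* :- (b :* s) :+ s := (con (+ 1) :- a :* b) :* s) refl _ _ _ ⟩
    (1# - g 0 * g 0 ⁻¹) * S                  ≈⟨ *-congʳ (+-congˡ (-‿cong (inverseʳ _ g₀≉0))) ⟩
    (1# - 1#) * S                            ≈⟨ trans (*-congʳ (-‿inverseʳ 1#)) (zeroˡ S) ⟩
    0#                                       ∎
    where S = ((g ∘ suc) ⊛ invPS g) n

  -- Reduces every later quotient of series to multiplying back, so the recursive inverse need not
  -- be expanded again.
  ⊘-unique : ∀ {f g h} → ¬ (g 0 ≈ 0#) → (h ⊛ g) ≈PS f → (f ⊘ g) ≈PS h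
  ⊘-unique {f} {g} {h} g₀≉0 hg≈f = P.trans (P.*-congʳ {invPS g} (P.sym {h ⊛ g} {f} hg≈f))
    (P.trans (P.*-assoc h g (invPS g))
    (P.trans (P.*-congˡ {h} (⊛-inverseʳ g g₀≉0)) (P.*-identityʳ h)))
    where module P = CommutativeRing powerSeriesRing

  evenPS-cong : ∀ {a b} → a ≈PS b → evenPS a ≈PS evenPS b
  evenPS-cong p zero          = p 0
  evenPS-cong p (suc zero)    = refl
  evenPS-cong p (suc (suc n)) = evenPS-cong (p ∘ suc) n

  evenPS-⊕ : ∀ a b → (evenPS a ⊕ evenPS b) ≈PS evenPS (a ⊕ b)
  evenPS-⊕ a b zero          = refl
  evenPS-⊕ a b (suc zero)    = +-identityʳ 0#
  evenPS-⊕ a b (suc (suc n)) = evenPS-⊕ (a ∘ suc) (b ∘ suc) n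

  evenPS-scale : ∀ x a → scalePS x (evenPS a) ≈PS evenPS (scalePS x a)
  evenPS-scale x a zero          = refl
  evenPS-scale x a (suc zero)    = zeroʳ x
  evenPS-scale x a (suc (suc n)) = evenPS-scale x (a ∘ suc) n

  -- The substitution v = z² is multiplicative. Induction goes in steps of two; the odd coefficient
  -- peeled on the way is 0.
  evenPS-⊛ : ∀ a b → (evenPS a ⊛ evenPS b) ≈PS evenPS (a ⊛ b)
  evenPS-⊛ a b zero       = refl
  evenPS-⊛ a b (suc zero) = solve 2 (λ x y →
    con (+ 0) :+ x :* con (+ 0) :+ con (+ 0) :* y := con (+ 0)) refl _ _
  evenPS-⊛ a b (suc (suc n)) = begin
    (evenPS a ⊛ evenPS b) (suc (suc n))
      ≈⟨ ⊛-suc (evenPS a) (evenPS b) (suc n) ⟩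
    a 0 * evenPS b′ n + ((evenPS a ∘ suc) ⊛ evenPS b) (suc n)
      ≈⟨ +-congˡ (⊛-suc (evenPS a ∘ suc) (evenPS b) n) ⟩
    a 0 * evenPS b′ n + (0# * evenPS b (suc n) + (evenPS a′ ⊛ evenPS b) n)
      ≈⟨ +-cong (evenPS-scale (a 0) b′ n) (trans (+-congʳ (zeroˡ _)) (+-identityˡ _)) ⟩
    evenPS (scalePS (a 0) b′) n + (evenPS a′ ⊛ evenPS b) n
      ≈⟨ +-congˡ (evenPS-⊛ a′ b n) ⟩
    evenPS (scalePS (a 0) b′) n + evenPS (a′ ⊛ b) n
      ≈⟨ evenPS-⊕ (scalePS (a 0) b′) (a′ ⊛ b) n ⟩
    evenPS (scalePS (a 0) b′ ⊕ (a′ ⊛ b)) n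
      ≈⟨ evenPS-cong (⊛-suc a b) n ⟨
    evenPS ((a ⊛ b) ∘ suc) n ∎
    where
    a′ = a ∘ suc
    b′ = b ∘ suc

  timesZ-cong : ∀ {f g} → f ≈PS g → timesZ f ≈PS timesZ g
  timesZ-cong p zero    = refl
  timesZ-cong p (suc n) = p n

  timesZ-⊛ : ∀ f g → (timesZ f ⊛ g) ≈PS timesZ (f ⊛ g)
  timesZ-⊛ f g zero    = trans (⊛-zero (timesZ f) g) (zeroˡ _)
  timesZ-⊛ f g (suc n) = trans (⊛-suc (timesZ f) g n) (trans (+-congʳ (zeroˡ _)) (+-identityˡ _))

  timesZ-scale : ∀ x f → scalePS x (timesZ f) ≈PS timesZ (scalePS x f)
  timesZ-scale x f zero    = zeroʳ x
  timesZ-scale x f (suc n) = refl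

  -- The first coefficient used by `oddPS` is a_1, at z. Here the sums from n = 1 in the theorem
  -- meet series indexed from 0.
  oddPS-tail : ∀ a → oddPS a ≈PS timesZ (evenPS (a ∘ suc))
  oddPS-tail a zero    = refl
  oddPS-tail a (suc n) = refl

-- Cancellation, powers and finite products in a field.

module FieldLemmas {c ℓ} (F : Field c ℓ) where
  open Field F renaming (zero to *-zero)
  open OverField F
  open IntegerSolver commutativeRing using (solve; _:=_; con; _:+_; _:*_)
  open import Relation.Binary.Reasoning.Setoid setoid

  *-cancelˡ-≉0 : ∀ {x y z} → ¬ (x ≈ 0#) → x * y ≈ x * z → y ≈ z
  *-cancelˡ-≉0 {x} {y} {z} x≉0 xy≈xz = begin
    y                  ≈⟨ unit y ⟨
    x ⁻¹ * (x * y)     ≈⟨ *-congˡ xy≈xz ⟩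
    x ⁻¹ * (x * z)     ≈⟨ unit z ⟩
    z                  ∎
    where
    unit : ∀ w → x ⁻¹ * (x * w) ≈ w
    unit w = trans (solve 3 (λ i x w → i :* (x :* w) := (x :* i) :* w) refl _ _ _)
      (trans (*-congʳ (inverseʳ x x≉0)) (*-identityˡ w))

  x*y≈0⇒y≈0 : ∀ {x y} → ¬ (x ≈ 0#) → x * y ≈ 0# → y ≈ 0#
  x*y≈0⇒y≈0 x≉0 xy≈0 = *-cancelˡ-≉0 x≉0 (trans xy≈0 (sym (zeroʳ _)))

  *-≉0 : ∀ {x y} → ¬ (x ≈ 0#) → ¬ (y ≈ 0#) → ¬ (x * y ≈ 0#)
  *-≉0 x≉0 y≉0 xy≈0 = y≉0 (x*y≈0⇒y≈0 x≉0 xy≈0)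

  ≉0-factorʳ : ∀ {x y} → ¬ (x * y ≈ 0#) → ¬ (y ≈ 0#)
  ≉0-factorʳ xy≉0 y≈0 = xy≉0 (trans (*-congˡ y≈0) (zeroʳ _))

  ≉0-resp-≈ : ∀ {x y} → x ≈ y → ¬ (x ≈ 0#) → ¬ (y ≈ 0#)
  ≉0-resp-≈ x≈y x≉0 y≈0 = x≉0 (trans x≈y y≈0)

  ⁻¹-≉0 : ∀ {x} → ¬ (x ≈ 0#) → ¬ (x ⁻¹ ≈ 0#)
  ⁻¹-≉0 x≉0 = ≉0-factorʳ (≉0-resp-≈ (sym (inverseʳ _ x≉0)) 1≉0)

  pow-+ : ∀ x m n → pow x (m ℕ.+ n) ≈ pow x m * pow x n
  pow-+ x zero    n = sym (*-identityˡ _)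
  pow-+ x (suc m) n = trans (*-congˡ (pow-+ x m n)) (sym (*-assoc _ _ _))

  pow-≉0 : ∀ {x} n → ¬ (x ≈ 0#) → ¬ (pow x n ≈ 0#)
  pow-≉0 zero    x≉0 = 1≉0
  pow-≉0 (suc n) x≉0 = *-≉0 x≉0 (pow-≉0 n x≉0)

  pow-cong : ∀ {x z} n → x ≈ z → pow x n ≈ pow z n
  pow-cong zero    x≈z = refl
  pow-cong (suc n) x≈z = *-cong x≈z (pow-cong n x≈z)

  prodTo-≉0 : ∀ n {f : ℕ → Carrier} → (∀ i → ¬ (f i ≈ 0#)) → ¬ (prodTo n f ≈ 0#)
  prodTo-≉0 zero    f≉0 = 1≉0
  prodTo-≉0 (suc n) f≉0 = *-≉0 (prodTo-≉0 n f≉0) (f≉0 n)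

  prodTo-cong : ∀ n {f g : ℕ → Carrier} → (∀ i → f i ≈ g i) → prodTo n f ≈ prodTo n g
  prodTo-cong zero    f≈g = refl
  prodTo-cong (suc n) f≈g = *-cong (prodTo-cong n f≈g) (f≈g n)

  prodTo-* : ∀ n (f g : ℕ → Carrier) → prodTo n (λ i → f i * g i) ≈ prodTo n f * prodTo n g
  prodTo-* zero    f g = sym (*-identityˡ 1#)
  prodTo-* (suc n) f g = trans (*-congʳ (prodTo-* n f g))
    (solve 4 (λ a b x y → (a :* b) :* (x :* y) := (a :* x) :* (b :* y)) refl _ _ _ _)

  fromℕ-+ : ∀ m n → fromℕ (m ℕ.+ n) ≈ fromℕ m + fromℕ n
  fromℕ-+ zero    n = sym (+-identityˡ _)
  fromℕ-+ (suc m) n = trans (+-congˡ (fromℕ-+ m n)) (sym (+-assoc _ _ _))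

  fromℕ-* : ∀ m n → fromℕ (m ℕ.* n) ≈ fromℕ m * fromℕ n
  fromℕ-* zero    n = sym (zeroˡ _)
  fromℕ-* (suc m) n = trans (fromℕ-+ n (m ℕ.* n)) (trans (+-congˡ (fromℕ-* m n))
    (solve 2 (λ a b → b :+ a :* b := (con (+ 1) :+ a) :* b) refl _ _))

  -- Allows Φ at ν and at ν+1 to be related through their recurrences, without manipulating shifted
  -- Pochhammer products.
  firstOrderUnique : ∀ {x y l m : ℕ → Carrier} → (∀ n → ¬ (l n ≈ 0#)) →
    (∀ n → l n * x (suc n) ≈ m n * x n) → (∀ n → l n * y (suc n) ≈ m n * y n) →
    x 0 ≈ y 0 → ∀ n → x n ≈ y n
  firstOrderUnique l≉0 hx hy h₀ zero    = h₀
  firstOrderUnique l≉0 hx hy h₀ (suc n) = *-cancelˡ-≉0 (l≉0 n)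
    (trans (hx n) (trans (*-congˡ (firstOrderUnique l≉0 hx hy h₀ n)) (sym (hy n))))

-- The linear equation against the Riccati equation.

module RingIdentity {c ℓ} (R : CommutativeRing c ℓ) where
  open CommutativeRing R
  open IntegerSolver R using (solve; _:=_; con; _:+_; _:*_; _:-_)

  -- Subtract the linear equation from φ times the Riccati equation and use r r₁ φ - φ₂ = r₁ (r φ -
  -- φ₁) + (r₁ φ₁ - φ₂). Only defects of the form r φ - φ₁ survive, and nothing is divided by φ.
  riccatiDefect : ∀ A T K φ φ₁ φ₂ r r₁ →
    φ - A * φ₁ + T * φ₂ + K * φ₁ ≈ 0# →
    1# - A * r + T * (r * r₁) + K * r ≈ 0# →
    (K - A) * (r * φ - φ₁) + T * (r₁ * φ₁ - φ₂) + T * (r₁ * (r * φ - φ₁)) ≈ 0#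
  riccatiDefect A T K φ φ₁ φ₂ r r₁ p q = trans
    (solve 8 (λ A T K φ φ₁ φ₂ r r₁ →
      (K :- A) :* (r :* φ :- φ₁) :+ T :* (r₁ :* φ₁ :- φ₂) :+ T :* (r₁ :* (r :* φ :- φ₁))
      := φ :* (con (+ 1) :- A :* r :+ T :* (r :* r₁) :+ K :* r)
         :- (φ :- A :* φ₁ :+ T :* φ₂ :+ K :* φ₁)) refl A T K φ φ₁ φ₂ r r₁)
    (trans (+-cong (trans (*-congˡ q) (zeroʳ φ)) (-‿cong p)) (-‿inverseʳ 0#))

-- The q-Riccati equation and its power series solution.

module Riccati {c ℓ} (F : Field c ℓ) where
  open Field F renaming (zero to *-zero)
  open OverField F
  open PowerSeries F
  open FieldLemmas F
  open IntegerSolver commutativeRing using (solve; _:=_; con; _:+_; _:*_; _:-_; :-_)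
  open import Relation.Binary.Reasoning.Setoid setoid
  private module P = CommutativeRing powerSeriesRing

  dilate : Carrier → PS → PS
  dilate x f n = pow x n * f n

  dilate-⊛ : ∀ x f g → dilate x (f ⊛ g) ≈PS (dilate x f ⊛ dilate x g)
  dilate-⊛ x f g n = trans (sym (sumTo-*ˡ (suc n) (pow x n) _))
    (sumTo-cong (suc n) λ { k (s≤s k≤n) → begin
      pow x n * (f k * g (n ∸ k))
        ≡⟨ ≡.cong (λ m → pow x m * (f k * g (n ∸ k))) (ℕ.m+[n∸m]≡n k≤n) ⟨
      pow x (k ℕ.+ (n ∸ k)) * (f k * g (n ∸ k))
        ≈⟨ *-congʳ (pow-+ x k (n ∸ k)) ⟩
      pow x k * pow x (n ∸ k) * (f k * g (n ∸ k))
        ≈⟨ solve 4 (λ a b c d → a :* b :* (c :* d) := (a :* c) :* (b :* d)) refl _ _ _ _ ⟩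
      pow x k * f k * (pow x (n ∸ k) * g (n ∸ k)) ∎ })

  ⊛-leading : ∀ f d n → (∀ {k} → k ℕ.< n → d k ≈ 0#) → (f ⊛ d) n ≈ f 0 * d n
  ⊛-leading f d zero    h = ⊛-zero f d
  ⊛-leading f d (suc n) h = trans (⊛-suc f d n) (trans
    (+-congˡ (sumTo-0 (suc n) λ k _ → trans (*-congˡ (h (s≤s (ℕ.m∸n≤m n k)))) (zeroʳ _)))
    (+-identityʳ _))

  monomial : Carrier → PS
  monomial x = timesZ (constPS x)

  monomial-⊛-suc : ∀ x f n → (monomial x ⊛ f) (suc n) ≈ x * f n
  monomial-⊛-suc x f n = trans (timesZ-⊛ (constPS x) f (suc n)) (⊛-constˡ x f n)

  monomial-⊛-zero : ∀ x f → (monomial x ⊛ f) 0 ≈ 0#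
  monomial-⊛-zero x f = timesZ-⊛ (constPS x) f 0

  -- The weight t q at i = 0 becomes 1 by adding the contribution (1 − q t) E_0 E_n
  -- of the term κ v r in the Riccati equation.
  rayleighWeight : Carrier → Carrier → ℕ → Carrier
  rayleighWeight q t zero    = 1#
  rayleighWeight q t (suc i) = t * pow q (suc (suc i))

  rayleighSum : Carrier → Carrier → PS → ℕ → Carrier
  rayleighSum q t E n = sumTo (suc n) λ i → rayleighWeight q t i * (E i * E (n ∸ i))

  module _ (q t κ : Carrier) (φ E : PS)
    (qt≉1 : ∀ k → ¬ (1# - pow q (suc k) * t ≈ 0#))
    (φ-rec : ∀ n → (1# - pow q (suc n)) * (1# - pow q (suc n) * t) * φ (suc n) ≈ - (κ * pow q n * φ n))
    (E-zero : (1# - q * t) * ((1# - q) * E 0) ≈ κ)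
    (E-suc : ∀ n → (1# - pow q (suc (suc n)) * t) * E (suc n) ≈ (1# - q) * rayleighSum q t E n)
    where

    private
      r A T K δ : PS
      r zero    = 1#
      r (suc n) = (1# - q) * E n
      A = constPS (1# + t)
      T = constPS t
      K = monomial κ
      δ = (r ⊛ φ) P.- dilate q φ

      -- On the coefficient of v^m the three dilations act as 1 - (1 + t) Q + t Q² = (1 - Q)(1 - t
      -- Q) with Q = q^m, which is the factor in `φ-rec`.
      φ-equation : (φ P.- (A ⊛ dilate q φ) ⊕ (T ⊛ dilate q (dilate q φ)) ⊕ (K ⊛ dilate q φ)) P.≈ P.0#
      φ-equation zero = trans
        (+-cong (+-cong (+-congˡ (-‿cong (⊛-constˡ (1# + t) (dilate q φ) 0))) (⊛-constˡ t (dilate q (dilate q φ)) 0))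
                (monomial-⊛-zero κ (dilate q φ)))
        (solve 2 (λ t x → x :- (con (+ 1) :+ t) :* (con (+ 1) :* x) :+ t :* (con (+ 1) :* (con (+ 1) :* x)) :+ con (+ 0) := con (+ 0)) refl t (φ 0))
      φ-equation (suc n) = begin
        _ ≈⟨ +-cong (+-cong (+-congˡ (-‿cong (⊛-constˡ (1# + t) (dilate q φ) (suc n))))
                            (⊛-constˡ t (dilate q (dilate q φ)) (suc n)))
                    (monomial-⊛-suc κ (dilate q φ) n) ⟩
        x - (1# + t) * (Q * x) + t * (Q * (Q * x)) + κ * (pow q n * φ n)
          ≈⟨ solve 5 (λ t x Q κ y → x :- (con (+ 1) :+ t) :* (Q :* x) :+ t :* (Q :* (Q :* x)) :+ y
               := (con (+ 1) :- Q) :* (con (+ 1) :- Q :* t) :* x :+ y) refl t x Q κ _ ⟩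
        (1# - Q) * (1# - Q * t) * x + κ * (pow q n * φ n)
          ≈⟨ +-cong (φ-rec n) (sym (*-assoc _ _ _)) ⟩
        - (κ * pow q n * φ n) + κ * pow q n * φ n
          ≈⟨ -‿inverseˡ _ ⟩
        0# ∎
        where
        x = φ (suc n)
        Q = pow q (suc n)

      -- The second summand is κ r_{n+1}, with κ expressed through `E-zero`. It merges with the
      -- first term of the convolution, since t q + (1 - q t) = 1.
      r-convolution : ∀ n →
        t * ((dilate q r ∘ suc) ⊛ (r ∘ suc)) n + (1# - q * t) * ((1# - q) * E 0) * ((1# - q) * E n)
        ≈ (1# - q) * ((1# - q) * rayleighSum q t E n)
      r-convolution n = begin
        t * ((dilate q r ∘ suc) ⊛ (r ∘ suc)) n + B
          ≈⟨ +-congʳ (*-congˡ (sumTo-front n _)) ⟩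
        t * (q * 1# * (u * E 0) * (u * E n) + S) + B
          ≈⟨ solve 6 (λ t q u x y S → t :* (q :* con (+ 1) :* (u :* x) :* (u :* y) :+ S) :+ (con (+ 1) :- q :* t) :* (u :* x) :* (u :* y)
               := u :* (u :* (con (+ 1) :* (x :* y))) :+ t :* S) refl t q u (E 0) (E n) S ⟩
        u * (u * (1# * (E 0 * E n))) + t * S
          ≈⟨ +-congˡ (trans (sym (sumTo-*ˡ n t _)) (trans (sumTo-cong n λ i _ →
               solve 5 (λ t Q u x y → t :* (Q :* (u :* x) :* (u :* y)) := (u :* u) :* (t :* Q :* (x :* y))) refl _ _ _ _ _)
               (sumTo-*ˡ n (u * u) _))) ⟩
        u * (u * (1# * (E 0 * E n))) + u * u * S′
          ≈⟨ solve 3 (λ u a b → u :* (u :* a) :+ u :* u :* b := u :* (u :* (a :+ b))) refl u _ S′ ⟩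
        u * (u * (1# * (E 0 * E n) + S′))
          ≈⟨ *-congˡ (*-congˡ (sumTo-front n _)) ⟨
        u * (u * rayleighSum q t E n) ∎
        where
        u = 1# - q
        B = (1# - q * t) * ((1# - q) * E 0) * ((1# - q) * E n)
        S = sumTo n λ i → dilate q r (suc (suc i)) * r (suc (n ∸ suc i))
        S′ = sumTo n λ i → rayleighWeight q t (suc i) * (E (suc i) * E (n ∸ suc i))

      -- The two end terms of r r_q at degree m contribute t (1 + q^m) r_m; with -(1 + t) r_m this
      -- leaves -(1 - t q^m) r_m, the left side of the recurrence for E. The inner terms and κ v r
      -- give its right side.
      riccati : (P.1# P.- (A ⊛ r) ⊕ (T ⊛ (r ⊛ dilate q r)) ⊕ (K ⊛ r)) P.≈ P.0#
      riccati zero = trans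
        (+-cong (+-cong (+-congˡ (-‿cong (⊛-constˡ (1# + t) r 0))) (⊛-constˡ t (r ⊛ dilate q r) 0))
                (monomial-⊛-zero κ r))
        (solve 1 (λ t → con (+ 1) :- (con (+ 1) :+ t) :* con (+ 1) :+ t :* (con (+ 0) :+ con (+ 1) :* (con (+ 1) :* con (+ 1))) :+ con (+ 0) := con (+ 0)) refl t)
      riccati (suc n) = begin
        _ ≈⟨ +-cong (+-cong (+-congˡ (-‿cong (⊛-constˡ (1# + t) r (suc n))))
                (trans (⊛-constˡ t (r ⊛ dilate q r) (suc n)) (*-congˡ (⊛-suc r (dilate q r) n))))
                (monomial-⊛-suc κ r n) ⟩
        0# - (1# + t) * r (suc n) + t * (1# * dilate q r (suc n) + ((r ∘ suc) ⊛ dilate q r) n) + κ * r n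
          ≈⟨ tail n ⟩
        0# ∎
        where
        tail : ∀ n → 0# - (1# + t) * r (suc n) + t * (1# * dilate q r (suc n) + ((r ∘ suc) ⊛ dilate q r) n) + κ * r n ≈ 0#
        tail zero = trans (+-congˡ (*-congʳ (sym E-zero)))
          (solve 4 (λ t q u e → con (+ 0) :- (con (+ 1) :+ t) :* (u :* e)
             :+ t :* (con (+ 1) :* (q :* con (+ 1) :* (u :* e)) :+ (con (+ 0) :+ (u :* e) :* (con (+ 1) :* con (+ 1))))
             :+ (con (+ 1) :- q :* t) :* (u :* e) :* con (+ 1) := con (+ 0)) refl t q (1# - q) (E 0))
        tail (suc n) = begin
          -- Swapping the factors puts the powers of q on the first index, where `rayleighWeight`
          -- has them.
          _ ≈⟨ +-cong (+-congˡ (*-congˡ (+-congˡ (trans (⊛-suc′ (r ∘ suc) (dilate q r) n)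
                 (+-congʳ (⊛-comm (r ∘ suc) (dilate q r ∘ suc) n))))))
                 (*-congʳ (sym E-zero)) ⟩
          0# - (1# + t) * (u * e) + t * (1# * (Q * (u * e)) + (X + u * e * (1# * 1#))) + B
            ≈⟨ solve 6 (λ t u e Q X B → con (+ 0) :- (con (+ 1) :+ t) :* (u :* e)
                 :+ t :* (con (+ 1) :* (Q :* (u :* e)) :+ (X :+ u :* e :* (con (+ 1) :* con (+ 1)))) :+ B
                 := (t :* X :+ B) :- u :* ((con (+ 1) :- Q :* t) :* e)) refl t u e Q X B ⟩
          t * X + B - u * ((1# - Q * t) * e)
            ≈⟨ +-cong (r-convolution n) (-‿cong (*-congˡ (E-suc n))) ⟩
          u * (u * rayleighSum q t E n) - u * (u * rayleighSum q t E n)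
            ≈⟨ -‿inverseʳ _ ⟩
          0# ∎
          where
          u = 1# - q
          e = E (suc n)
          Q = pow q (suc (suc n))
          X = ((dilate q r ∘ suc) ⊛ (r ∘ suc)) n
          B = (1# - q * t) * ((1# - q) * E 0) * ((1# - q) * E n)

      -- Linear and homogeneous in δ, with (t q^n − 1) δ_n as leading part of the
      -- n-th coefficient.
      δ-equation : (((K P.- A) ⊛ δ) ⊕ (T ⊛ dilate q δ) ⊕ (T ⊛ (dilate q r ⊛ δ))) P.≈ P.0#
      δ-equation n = trans
        (+-congʳ {(T ⊛ (dilate q r ⊛ δ)) n} (+-congˡ (⊛-cong {T} (λ _ → refl) dilate-δ n)))
        (RingIdentity.riccatiDefect powerSeriesRing A T K φ (dilate q φ) (dilate q (dilate q φ)) r (dilate q r)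
          φ-equation riccati n)
        where
        dilate-δ : dilate q δ P.≈ ((dilate q r ⊛ dilate q φ) P.- dilate q (dilate q φ))
        dilate-δ n = trans
          (solve 3 (λ a b c → a :* (b :- c) := a :* b :- a :* c) refl _ _ _)
          (+-congʳ (dilate-⊛ q r φ n))

      δ≈0 : ∀ n → δ n ≈ 0#
      δ≈0 = <-rec _ step
        where
        step : ∀ n → (∀ {k} → k ℕ.< n → δ k ≈ 0#) → δ n ≈ 0#
        -- Degree 0 is settled directly from r_0 = 1: the leading factor would be t - 1 there, which
        -- vanishes for ν = 0.
        step zero    _  = solve 1 (λ x → con (+ 0) :+ con (+ 1) :* x :- con (+ 1) :* x := con (+ 0)) refl (φ 0)
        step (suc n) ih = x*y≈0⇒y≈0 (qt≉1 n) (begin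
          (1# - Q * t) * d
            ≈⟨ solve 3 (λ Q t d → (con (+ 1) :- Q :* t) :* d
                 := :- ((con (+ 0) :- (con (+ 1) :+ t)) :* d :+ t :* (Q :* d) :+ t :* (con (+ 1) :* con (+ 1) :* d))) refl Q t d ⟩
          - ((0# - (1# + t)) * d + t * (Q * d) + t * (1# * 1# * d))
            -- Only the constant terms of K - A and of the dilated r act on δ_{n+1}, namely -(1 + t)
            -- and 1; all other products involve lower coefficients of δ.
            ≈⟨ -‿cong (+-cong (+-cong (⊛-leading (K P.- A) δ (suc n) ih) (⊛-constˡ t (dilate q δ) (suc n)))
                 (trans (⊛-constˡ t (dilate q r ⊛ δ) (suc n)) (*-congˡ (⊛-leading (dilate q r) δ (suc n) ih)))) ⟨
          - ((((K P.- A) ⊛ δ) ⊕ (T ⊛ dilate q δ) ⊕ (T ⊛ (dilate q r ⊛ δ))) (suc n))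
            ≈⟨ -‿cong (δ-equation (suc n)) ⟩
          - 0#
            ≈⟨ solve 0 (:- con (+ 0) := con (+ 0)) refl ⟩
          0# ∎)
          where
          Q = pow q (suc n)
          d = δ (suc n)

    -- This is r φ = φ_q at degree n + 1, with the term r_0 φ_{n+1} moved to the right. The right
    -- side is the coefficient of φ_q - φ, which each base then identifies with Φ at ν+1.
    E⊛φ : ∀ n → (1# - q) * (E ⊛ φ) n ≈ - ((1# - pow q (suc n)) * φ (suc n))
    E⊛φ n = begin
      (1# - q) * (E ⊛ φ) n
        ≈⟨ ⊛-scaleˡ (1# - q) E φ n ⟨
      Y
        ≈⟨ solve 3 (λ x Q y → y := (con (+ 1) :* x :+ y :- Q :* x) :- (con (+ 1) :- Q) :* x) refl x Q Y ⟩
      1# * x + Y - Q * x - (1# - Q) * x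
        ≈⟨ +-congʳ (+-congʳ (⊛-suc r φ n)) ⟨
      δ (suc n) - (1# - Q) * x
        ≈⟨ +-congʳ (δ≈0 (suc n)) ⟩
      0# - (1# - Q) * x
        ≈⟨ +-identityˡ _ ⟩
      - ((1# - Q) * x) ∎
      where
      x = φ (suc n)
      Q = pow q (suc n)
      Y = ((r ∘ suc) ⊛ φ) n

-- Polynomials with nonnegative coefficients, and the numerators.

Monomial : Set
Monomial = ℕ × ℕ × ℕ × ℕ

infixl 7 _·ᵐ_ _·ᵖ_

_·ᵐ_ : Monomial → Monomial → Monomial
(c , i , j , k) ·ᵐ (c′ , i′ , j′ , k′) = c ℕ.* c′ , i ℕ.+ i′ , j ℕ.+ j′ , k ℕ.+ k′

_·ᵖ_ : Poly3 → Poly3 → Poly3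
[]       ·ᵖ ns = []
(m ∷ ms) ·ᵖ ns = map (m ·ᵐ_) ns ++ ms ·ᵖ ns

1ᵖ : Poly3
1ᵖ = (1 , 0 , 0 , 0) ∷ []

sumᵖ : ℕ → (ℕ → Poly3) → Poly3
sumᵖ zero    f = []
sumᵖ (suc n) f = sumᵖ n f ++ f n

prodᵖ : ℕ → (ℕ → Poly3) → Poly3
prodᵖ zero    f = 1ᵖ
prodᵖ (suc n) f = prodᵖ n f ·ᵖ f n

powᵖ : Poly3 → ℕ → Poly3
powᵖ f zero    = 1ᵖ
powᵖ f (suc n) = f ·ᵖ powᵖ f n

-- Built on [k+1+ν] = 1 + q [k+ν], which is free of subtraction; the third variable stands for [ν].
bracketᵖ : ℕ → Poly3
bracketᵖ zero    = (1 , 0 , 0 , 1) ∷ []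
bracketᵖ (suc k) = (1 , 0 , 0 , 0) ∷ map ((1 , 1 , 0 , 0) ·ᵐ_) (bracketᵖ k)

weightᵖ : ℕ → Poly3
weightᵖ zero    = 1ᵖ
weightᵖ (suc i) = (1 , suc (suc i) , 1 , 0) ∷ []

-- The exponent of [j+1+ν] in D_{n+2} / (D_{i+1} D_{n-i+1}). For i ≤ n the truncated subtraction is
-- exact, by `/-superadditive`.
excess : ℕ → ℕ → ℕ → ℕ
excess n i j = suc (suc n) / suc j ∸ suc i / suc j ∸ suc (n ∸ i) / suc j

-- D_{n+2} / ([n+2+ν] D_{i+1} D_{n-i+1})
cofactorᵖ : ℕ → ℕ → Poly3
cofactorᵖ n i = prodᵖ (suc n) λ j → powᵖ (bracketᵖ (suc j)) (excess n i j)

-- history n j is N_{n-j+1}, so that history n 0 is the newest value.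
history : ℕ → ℕ → Poly3
history zero    j       = 1ᵖ
history (suc n) (suc j) = history n j
history (suc n) zero    = sumᵖ (suc n) λ i →
  weightᵖ i ·ᵖ (cofactorᵖ n i ·ᵖ (history n (n ∸ i) ·ᵖ history n i))

numerator : ℕ → Poly3
-- A filler value: `oddPS` discards index 0.
numerator zero    = []
numerator (suc n) = history n 0

history≡numerator : ∀ n j → j ℕ.≤ n → history n j ≡ numerator (suc (n ∸ j))
history≡numerator n       zero    _         = ≡.refl
history≡numerator (suc n) (suc j) (s≤s j≤n) = history≡numerator n j j≤n

-- The sum of the two floors times the divisor is at most k + l, and dividing that multiple by the
-- divisor is exact.
/-superadditive : ∀ k l d → k / suc d ℕ.+ l / suc d ℕ.≤ (k ℕ.+ l) / suc d
/-superadditive k l d = begin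
  k / suc d ℕ.+ l / suc d
    ≡⟨ m*n/n≡m _ (suc d) ⟨
  (k / suc d ℕ.+ l / suc d) ℕ.* suc d / suc d
    ≡⟨ ≡.cong (_/ suc d) (ℕ.*-distribʳ-+ (suc d) (k / suc d) (l / suc d)) ⟩
  (k / suc d ℕ.* suc d ℕ.+ l / suc d ℕ.* suc d) / suc d
    ≤⟨ /-monoˡ-≤ (suc d) (ℕ.+-mono-≤ (m/n*n≤m k (suc d)) (m/n*n≤m l (suc d))) ⟩
  (k ℕ.+ l) / suc d ∎
  where open ℕ.≤-Reasoning

excess-splits : ∀ n i j → i ℕ.≤ n →
  excess n i j ℕ.+ (suc i / suc j ℕ.+ suc (n ∸ i) / suc j) ≡ suc (suc n) / suc j
excess-splits n i j i≤n = ≡.trans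
  (≡.cong (ℕ._+ (b ℕ.+ c)) (ℕ.∸-+-assoc (suc (suc n) / suc j) b c))
  (ℕ.m∸n+n≡m (≡.subst (λ m → b ℕ.+ c ℕ.≤ m / suc j)
    (≡.trans (ℕ.+-suc (suc i) (n ∸ i)) (≡.cong (suc ∘ suc) (ℕ.m+[n∸m]≡n i≤n)))
    (/-superadditive (suc i) (suc (n ∸ i)) j)))
  where
  b = suc i / suc j
  c = suc (n ∸ i) / suc j

-- Evaluation of the polynomials as a homomorphism.

module Evaluation {c ℓ} (F : Field c ℓ) (x y w : Field.Carrier F) where
  open Field F
  open OverField F
  open PowerSeries F using (sumTo-cong)
  open FieldLemmas F
  open IntegerSolver commutativeRing using (solve; _:=_; con; _:+_; _:*_)
  open import Relation.Binary.Reasoning.Setoid setoid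

  eval : Poly3 → Carrier
  eval p = eval3 p x y w

  evalᵐ : Monomial → Carrier
  evalᵐ (c₀ , i , j , k) = fromℕ c₀ * pow x i * pow y j * pow w k

  evalᵐ-· : ∀ m n → evalᵐ (m ·ᵐ n) ≈ evalᵐ m * evalᵐ n
  evalᵐ-· (c , i , j , k) (c′ , i′ , j′ , k′) = trans
    (*-cong (*-cong (*-cong (fromℕ-* c c′) (pow-+ x i i′)) (pow-+ y j j′)) (pow-+ w k k′))
    (solve 8 (λ a b d e a′ b′ d′ e′ → a :* a′ :* (b :* b′) :* (d :* d′) :* (e :* e′)
       := a :* b :* d :* e :* (a′ :* b′ :* d′ :* e′)) refl _ _ _ _ _ _ _ _)

  eval-++ : ∀ p r → eval (p ++ r) ≈ eval p + eval r
  eval-++ []      r = sym (+-identityˡ _)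
  eval-++ (m ∷ p) r = trans (+-congˡ (eval-++ p r)) (sym (+-assoc _ _ _))

  eval-map : ∀ m p → eval (map (m ·ᵐ_) p) ≈ evalᵐ m * eval p
  eval-map m []      = sym (zeroʳ _)
  eval-map m (n ∷ p) = trans (+-cong (evalᵐ-· m n) (eval-map m p)) (sym (distribˡ _ _ _))

  eval-· : ∀ p r → eval (p ·ᵖ r) ≈ eval p * eval r
  eval-· []      r = sym (zeroˡ _)
  eval-· (m ∷ p) r = trans (eval-++ (map (m ·ᵐ_) r) (p ·ᵖ r))
    (trans (+-cong (eval-map m r) (eval-· p r)) (sym (distribʳ _ _ _)))

  eval-1 : eval 1ᵖ ≈ 1#
  eval-1 = solve 0 ((con (+ 1) :+ con (+ 0)) :* con (+ 1) :* con (+ 1) :* con (+ 1) :+ con (+ 0) := con (+ 1)) refl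

  eval-sum : ∀ n f → eval (sumᵖ n f) ≈ sumTo n (eval ∘ f)
  eval-sum zero    f = refl
  eval-sum (suc n) f = trans (eval-++ (sumᵖ n f) (f n)) (+-congʳ (eval-sum n f))

  eval-prod : ∀ n f → eval (prodᵖ n f) ≈ prodTo n (eval ∘ f)
  eval-prod zero    f = eval-1
  eval-prod (suc n) f = trans (eval-· (prodᵖ n f) (f n)) (*-congʳ (eval-prod n f))

  eval-pow : ∀ p n → eval (powᵖ p n) ≈ pow (eval p) n
  eval-pow p zero    = eval-1
  eval-pow p (suc n) = trans (eval-· p (powᵖ p n)) (*-congˡ (eval-pow p n))

-- The recurrence for C_n = N_n / D_n.

module Recursion {c ℓ} (F : Field c ℓ) where
  open Field F
  open OverField F
  open PowerSeries F
  open FieldLemmas F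
  open Riccati F
  open IntegerSolver commutativeRing using (solve; _:=_; con; _:+_; _:*_; _:-_)
  open import Relation.Binary.Reasoning.Setoid setoid

  module Numerators (q t : Carrier)
    (q^k≉1 : ∀ k → ¬ ((1# - pow q (suc k)) ≈ 0#))
    (q^kt≉1 : ∀ k → ¬ ((1# - pow q (suc k) * t) ≈ 0#))
    where
    open Evaluation F q t (qBracketν q t)

    br : ℕ → Carrier
    br = qBracketShift q t

    1-q≉0 : ¬ ((1# - q) ≈ 0#)
    1-q≉0 = ≉0-resp-≈ (+-congˡ (-‿cong (*-identityʳ q))) (q^k≉1 0)

    br≉0 : ∀ k → ¬ (br (suc k) ≈ 0#)
    br≉0 k = *-≉0 (q^kt≉1 k) (⁻¹-≉0 1-q≉0)

    br-cancel : ∀ k → (1# - q) * br k ≈ 1# - pow q k * t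
    br-cancel k = trans (solve 3 (λ u a i → u :* (a :* i) := (u :* i) :* a) refl _ _ _)
      (trans (*-congʳ (inverseʳ _ 1-q≉0)) (*-identityˡ _))

    eval-bracket : ∀ k → eval (bracketᵖ k) ≈ br k
    eval-bracket zero = solve 2 (λ t i →
      (con (+ 1) :+ con (+ 0)) :* con (+ 1) :* con (+ 1) :* ((con (+ 1) :- t) :* i :* con (+ 1)) :+ con (+ 0)
        := (con (+ 1) :- con (+ 1) :* t) :* i) refl t ((1# - q) ⁻¹)
    eval-bracket (suc k) = begin
      evalᵐ (1 , 0 , 0 , 0) + eval (map ((1 , 1 , 0 , 0) ·ᵐ_) (bracketᵖ k))
        ≈⟨ +-congˡ (trans (eval-map (1 , 1 , 0 , 0) (bracketᵖ k)) (*-congˡ (eval-bracket k))) ⟩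
      evalᵐ (1 , 0 , 0 , 0) + evalᵐ (1 , 1 , 0 , 0) * br k
        ≈⟨ solve 2 (λ q b → (con (+ 1) :+ con (+ 0)) :* con (+ 1) :* con (+ 1) :* con (+ 1)
              :+ (con (+ 1) :+ con (+ 0)) :* (q :* con (+ 1)) :* con (+ 1) :* con (+ 1) :* b
              := con (+ 1) :+ q :* b) refl q (br k) ⟩
      1# + q * br k
        -- Writing 1 as (1 - q)(1 - q)⁻¹ puts both terms over 1 - q, where the q in the middle
        -- telescopes.
        ≈⟨ +-congʳ (inverseʳ _ 1-q≉0) ⟨
      (1# - q) * (1# - q) ⁻¹ + q * br k
        ≈⟨ solve 4 (λ q Q t i → (con (+ 1) :- q) :* i :+ q :* ((con (+ 1) :- Q :* t) :* i)
              := (con (+ 1) :- q :* Q :* t) :* i) refl q (pow q k) t ((1# - q) ⁻¹) ⟩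
      br (suc k) ∎

    eval-weight : ∀ i → eval (weightᵖ i) ≈ rayleighWeight q t i
    eval-weight zero    = eval-1
    eval-weight (suc i) = solve 2 (λ Q t →
      (con (+ 1) :+ con (+ 0)) :* Q :* (t :* con (+ 1)) :* con (+ 1) :+ con (+ 0) := t :* Q) refl _ t

    D : ℕ → Carrier
    D = Dnν q t

    D≉0 : ∀ n → ¬ (D n ≈ 0#)
    D≉0 n = prodTo-≉0 n (λ i → pow-≉0 (n / suc i) (br≉0 i))

    -- The exponent ⌊k/(j+1)⌋ is 0 for j ≥ k. This lets denominators of different index be written
    -- over one common range of brackets.
    D-extend : ∀ {k m} → k ℕ.≤′ m → D k ≈ prodTo m (λ j → pow (br (suc j)) (k / suc j))
    D-extend (ℕ.≤′-reflexive ≡.refl) = refl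
    D-extend {k} {suc m} (ℕ.≤′-step k≤m) = trans (D-extend k≤m) (trans (sym (*-identityʳ _))
      (*-congˡ (reflexive (≡.cong (pow (br (suc m))) (≡.sym (m<n⇒m/n≡0 (s≤s (ℕ.≤′⇒≤ k≤m))))))))

    cofactor : ℕ → ℕ → Carrier
    cofactor n i = prodTo (suc n) λ j → pow (br (suc j)) (excess n i j)

    eval-cofactor : ∀ n i → eval (cofactorᵖ n i) ≈ cofactor n i
    eval-cofactor n i = trans (eval-prod (suc n) _) (prodTo-cong (suc n) λ j →
      trans (eval-pow (bracketᵖ (suc j)) (excess n i j)) (pow-cong (excess n i j) (eval-bracket (suc j))))

    -- The last bracket [n+2+ν] has exponent 1 in D_{n+2} and is the one on the left of the
    -- recurrence. The other n + 1 brackets are compared exponent by exponent.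
    D-split : ∀ n i → i ℕ.≤ n →
      D (suc (suc n)) ≈ br (suc (suc n)) * (cofactor n i * (D (suc i) * D (suc (n ∸ i))))
    D-split n i i≤n = begin
      prodTo (suc n) (λ j → pow (br (suc j)) (suc (suc n) / suc j)) * pow (br (suc (suc n))) (suc (suc n) / suc (suc n))
        ≈⟨ *-cong (prodTo-cong (suc n) split)
             (trans (reflexive (≡.cong (pow (br (suc (suc n)))) (n/n≡1 (suc (suc n))))) (*-identityʳ _)) ⟩
      prodTo (suc n) (λ j → e j * (a j * b j)) * br (suc (suc n))
        ≈⟨ *-comm _ _ ⟩
      br (suc (suc n)) * prodTo (suc n) (λ j → e j * (a j * b j))
        ≈⟨ *-congˡ (trans (prodTo-* (suc n) e (λ j → a j * b j)) (*-congˡ (prodTo-* (suc n) a b))) ⟩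
      br (suc (suc n)) * (cofactor n i * (prodTo (suc n) a * prodTo (suc n) b))
        ≈⟨ *-congˡ (*-congˡ (*-cong (D-extend (ℕ.≤⇒≤′ (s≤s i≤n))) (D-extend (ℕ.≤⇒≤′ (s≤s (ℕ.m∸n≤m n i)))))) ⟨
      br (suc (suc n)) * (cofactor n i * (D (suc i) * D (suc (n ∸ i)))) ∎
      where
      e a b : ℕ → Carrier
      e j = pow (br (suc j)) (excess n i j)
      a j = pow (br (suc j)) (suc i / suc j)
      b j = pow (br (suc j)) (suc (n ∸ i) / suc j)
      split : ∀ j → pow (br (suc j)) (suc (suc n) / suc j) ≈ e j * (a j * b j)
      split j = trans (reflexive (≡.cong (pow (br (suc j))) (≡.sym (excess-splits n i j i≤n))))
        (trans (pow-+ _ (excess n i j) _) (*-congˡ (pow-+ _ (suc i / suc j) (suc (n ∸ i) / suc j))))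

    N : ℕ → Carrier
    N n = Nnν numerator q t n

    -- This is C_{n+1}, shifted so that the series in v begins with C_1.
    ratio : ℕ → Carrier
    ratio n = N (suc n) * D (suc n) ⁻¹

    ratio*D : ∀ n → ratio n * D (suc n) ≈ N (suc n)
    ratio*D n = trans (*-assoc _ _ _) (trans (*-congˡ (trans (*-comm _ _) (inverseʳ _ (D≉0 (suc n))))) (*-identityʳ _))

    N-suc-suc : ∀ n → N (suc (suc n)) ≈ sumTo (suc n) λ i →
      rayleighWeight q t i * (cofactor n i * (N (suc i) * N (suc (n ∸ i))))
    N-suc-suc n = trans (eval-sum (suc n) _) (sumTo-cong (suc n) λ { i (s≤s i≤n) → begin
      eval (weightᵖ i ·ᵖ (cofactorᵖ n i ·ᵖ (history n (n ∸ i) ·ᵖ history n i)))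
        ≈⟨ trans (eval-· (weightᵖ i) _) (*-congˡ (trans (eval-· (cofactorᵖ n i) _) (*-congˡ (eval-· (history n (n ∸ i)) _)))) ⟩
      eval (weightᵖ i) * (eval (cofactorᵖ n i) * (eval (history n (n ∸ i)) * eval (history n i)))
        ≈⟨ *-cong (eval-weight i) (*-cong (eval-cofactor n i) (*-cong
             (reflexive (≡.cong eval (≡.trans (history≡numerator n (n ∸ i) (ℕ.m∸n≤m n i))
                (≡.cong (numerator ∘ suc) (ℕ.m∸[m∸n]≡n i≤n)))))
             (reflexive (≡.cong eval (history≡numerator n i i≤n))))) ⟩
      rayleighWeight q t i * (cofactor n i * (N (suc i) * N (suc (n ∸ i)))) ∎ })

    ratio-zero : br 1 * ratio 0 ≈ 1#
    ratio-zero = begin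
      br 1 * ratio 0                      ≈⟨ *-comm _ _ ⟩
      ratio 0 * br 1                      ≈⟨ *-congˡ (solve 1 (λ b → b := con (+ 1) :* (b :* con (+ 1))) refl (br 1)) ⟩
      ratio 0 * D 1                       ≈⟨ ratio*D 0 ⟩
      N 1                             ≈⟨ eval-1 ⟩
      1#                              ∎

    -- Multiply by D_{n+2}: by `D-split` each summand on the right loses its denominators and
    -- becomes a summand of N_{n+2}.
    ratio-suc : ∀ n → br (suc (suc n)) * ratio (suc n) ≈ rayleighSum q t ratio n
    ratio-suc n = *-cancelˡ-≉0 (D≉0 (suc (suc n))) (begin
      d * (b * ratio (suc n))
        ≈⟨ solve 3 (λ d b c → d :* (b :* c) := b :* (c :* d)) refl _ _ _ ⟩
      b * (ratio (suc n) * d)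
        ≈⟨ *-congˡ (trans (ratio*D (suc n)) (N-suc-suc n)) ⟩
      b * sumTo (suc n) (λ i → rayleighWeight q t i * (cofactor n i * (N (suc i) * N (suc (n ∸ i)))))
        ≈⟨ sumTo-*ˡ (suc n) b _ ⟨
      sumTo (suc n) (λ i → b * (rayleighWeight q t i * (cofactor n i * (N (suc i) * N (suc (n ∸ i))))))
        ≈⟨ sumTo-cong (suc n) (λ { i (s≤s i≤n) → term i i≤n }) ⟩
      sumTo (suc n) (λ i → d * (rayleighWeight q t i * (ratio i * ratio (n ∸ i))))
        ≈⟨ sumTo-*ˡ (suc n) d _ ⟩
      d * rayleighSum q t ratio n ∎)
      where
      b = br (suc (suc n))
      d = D (suc (suc n))
      term : ∀ i → i ℕ.≤ n → b * (rayleighWeight q t i * (cofactor n i * (N (suc i) * N (suc (n ∸ i)))))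
        ≈ d * (rayleighWeight q t i * (ratio i * ratio (n ∸ i)))
      term i i≤n = begin
        b * (rayleighWeight q t i * (cofactor n i * (N (suc i) * N (suc (n ∸ i)))))
          ≈⟨ *-congˡ (*-congˡ (*-congˡ (*-cong (ratio*D i) (ratio*D (n ∸ i))))) ⟨
        b * (rayleighWeight q t i * (cofactor n i * (ratio i * D (suc i) * (ratio (n ∸ i) * D (suc (n ∸ i))))))
          ≈⟨ solve 7 (λ b w e x x′ y y′ → b :* (w :* (e :* (x :* x′ :* (y :* y′))))
               := b :* (e :* (x′ :* y′)) :* (w :* (x :* y))) refl _ _ _ _ _ _ _ ⟩
        b * (cofactor n i * (D (suc i) * D (suc (n ∸ i)))) * (rayleighWeight q t i * (ratio i * ratio (n ∸ i)))
          ≈⟨ *-congʳ (D-split n i i≤n) ⟨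
        d * (rayleighWeight q t i * (ratio i * ratio (n ∸ i))) ∎

    module _ (x : Carrier) where

      scaledRatio : PS
      scaledRatio n = ratio n * pow x (suc n)

      scaledRatio-zero : (1# - q * t) * ((1# - q) * scaledRatio 0) ≈ x * (1# - q) * (1# - q)
      scaledRatio-zero = begin
        (1# - q * t) * ((1# - q) * (ratio 0 * (x * 1#)))
          ≈⟨ *-congʳ (trans (br-cancel 1) (solve 2 (λ q t → con (+ 1) :- q :* con (+ 1) :* t := con (+ 1) :- q :* t) refl q t)) ⟨
        (1# - q) * br 1 * ((1# - q) * (ratio 0 * (x * 1#)))
          ≈⟨ solve 4 (λ u b c x → u :* b :* (u :* (c :* (x :* con (+ 1)))) := b :* c :* (x :* u :* u)) refl _ _ _ _ ⟩
        br 1 * ratio 0 * (x * (1# - q) * (1# - q))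
          ≈⟨ trans (*-congʳ ratio-zero) (*-identityˡ _) ⟩
        x * (1# - q) * (1# - q) ∎

      -- Every product in the sum has total index n + 2, so the powers of x factor out; x survives
      -- only in the initial value, where it fixes κ.
      scaledRatio-suc : ∀ n → (1# - pow q (suc (suc n)) * t) * scaledRatio (suc n) ≈ (1# - q) * rayleighSum q t scaledRatio n
      scaledRatio-suc n = begin
        (1# - pow q (suc (suc n)) * t) * (ratio (suc n) * X)
          ≈⟨ *-congʳ (br-cancel (suc (suc n))) ⟨
        (1# - q) * br (suc (suc n)) * (ratio (suc n) * X)
          ≈⟨ solve 4 (λ u b c X → u :* b :* (c :* X) := u :* (X :* (b :* c))) refl _ _ _ _ ⟩
        (1# - q) * (X * (br (suc (suc n)) * ratio (suc n)))
          ≈⟨ *-congˡ (trans (*-congˡ (ratio-suc n)) (sym (sumTo-*ˡ (suc n) X _))) ⟩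
        (1# - q) * sumTo (suc n) (λ i → X * (rayleighWeight q t i * (ratio i * ratio (n ∸ i))))
          ≈⟨ *-congˡ (sumTo-cong (suc n) λ { i (s≤s i≤n) → trans (*-congʳ (X-split i i≤n))
               (solve 5 (λ a b w c d → a :* b :* (w :* (c :* d)) := w :* (c :* a :* (d :* b))) refl _ _ _ _ _) }) ⟩
        (1# - q) * rayleighSum q t scaledRatio n ∎
        where
        X = pow x (suc (suc n))
        X-split : ∀ i → i ℕ.≤ n → X ≈ pow x (suc i) * pow x (suc (n ∸ i))
        X-split i i≤n = trans (reflexive (≡.cong (pow x)
          (≡.sym (≡.trans (ℕ.+-suc (suc i) (n ∸ i)) (≡.cong (suc ∘ suc) (ℕ.m+[n∸m]≡n i≤n))))))
          (pow-+ x (suc i) (suc (n ∸ i)))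

-- Coefficients of Φ and quotients of even series.

module HahnExton {c ℓ} (F : Field c ℓ) where
  open Field F renaming (zero to *-zero)
  open OverField F
  open PowerSeries F
  open FieldLemmas F
  open IntegerSolver commutativeRing using (solve; _:=_; con; _:*_; _:-_; :-_)
  open import Relation.Binary.Reasoning.Setoid setoid

  -- Kept in the exact form used by `PhiPS`, so that `PhiPS a p c₀` is `evenPS (phi a p c₀)` by
  -- computation.
  phi : (a p c₀ : Carrier) → ℕ → Carrier
  phi a p c₀ n = pow (- 1#) n * pow p (n C 2) * pow (p * c₀ * c₀) n * (qPoch p p n * qPoch a p n) ⁻¹

  pow-C2 : ∀ p n → pow p (suc n C 2) ≈ pow p n * pow p (n C 2)
  pow-C2 p n = trans
    (reflexive (≡.cong (pow p) (≡.trans (≡.sym (nCk+nC[k+1]≡[n+1]C[k+1] n 1)) (≡.cong (ℕ._+ n C 2) (nC1≡n n)))))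
    (pow-+ p n (n C 2))

  module _ {a p : Carrier} (c₀ : Carrier)
    (p≉1 : ∀ n → ¬ (1# - pow p (suc n) ≈ 0#))
    (a≉1 : ∀ n → ¬ (1# - a * pow p n ≈ 0#))
    where

    private
      W : ℕ → Carrier
      W n = qPoch p p n * qPoch a p n

      W-suc : ∀ n → W (suc n) ≈ W n * ((1# - pow p (suc n)) * (1# - a * pow p n))
      W-suc n = solve 4 (λ x y u v → x :* u :* (y :* v) := x :* y :* (u :* v)) refl _ _ _ _

      W≉0 : ∀ n → ¬ (W n ≈ 0#)
      W≉0 zero    = ≉0-resp-≈ (sym (*-identityˡ 1#)) 1≉0
      W≉0 (suc n) = ≉0-resp-≈ (sym (W-suc n)) (*-≉0 (W≉0 n) (*-≉0 (p≉1 n) (a≉1 n)))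

      W*phi : ∀ n → W n * phi a p c₀ n ≈ pow (- 1#) n * pow p (n C 2) * pow (p * c₀ * c₀) n
      W*phi n = trans (solve 3 (λ w x i → w :* (x :* i) := x :* (w :* i)) refl _ _ _)
        (trans (*-congˡ (inverseʳ _ (W≉0 n))) (*-identityʳ _))

    phi-zero : phi a p c₀ 0 ≈ 1#
    phi-zero = trans (sym (*-identityˡ _)) (trans (*-congʳ (sym (*-identityˡ 1#)))
      (trans (W*phi 0) (trans (*-identityʳ _) (*-identityˡ _))))

    phi-suc : ∀ n → (1# - pow p (suc n)) * (1# - a * pow p n) * phi a p c₀ (suc n)
      ≈ - (pow p n * (p * c₀ * c₀) * phi a p c₀ n)
    phi-suc n = *-cancelˡ-≉0 (W≉0 n) (begin
      W n * ((1# - pow p (suc n)) * (1# - a * pow p n) * phi a p c₀ (suc n))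
        ≈⟨ *-assoc _ _ _ ⟨
      W n * ((1# - pow p (suc n)) * (1# - a * pow p n)) * phi a p c₀ (suc n)
        ≈⟨ *-congʳ (W-suc n) ⟨
      W (suc n) * phi a p c₀ (suc n)
        ≈⟨ W*phi (suc n) ⟩
      - 1# * pow (- 1#) n * pow p (suc n C 2) * (p * c₀ * c₀ * pow (p * c₀ * c₀) n)
        ≈⟨ *-congʳ (*-congˡ (pow-C2 p n)) ⟩
      - 1# * pow (- 1#) n * (pow p n * pow p (n C 2)) * (p * c₀ * c₀ * pow (p * c₀ * c₀) n)
        ≈⟨ solve 5 (λ s P b u x → :- con (+ 1) :* s :* (P :* b) :* (u :* x) := :- (P :* u :* (s :* b :* x))) refl _ _ _ _ _ ⟩
      - (pow p n * (p * c₀ * c₀) * (pow (- 1#) n * pow p (n C 2) * pow (p * c₀ * c₀) n))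
        ≈⟨ -‿cong (*-congˡ (W*phi n)) ⟨
      - (pow p n * (p * c₀ * c₀) * (W n * phi a p c₀ n))
        ≈⟨ solve 3 (λ k w x → :- (k :* (w :* x)) := w :* (:- (k :* x))) refl _ _ _ ⟩
      W n * - (pow p n * (p * c₀ * c₀) * phi a p c₀ n) ∎)

  -- Both Bessel quotients have the shape κ z ψ(z²) / φ(z²), so each expansion comes down to y φ = κ
  -- ψ in the variable v.
  oddQuotient : ∀ {κ φ ψ y} → φ 0 ≈ 1# → (∀ n → (y ⊛ φ) n ≈ κ * ψ n) →
    (scalePS κ (timesZ (evenPS ψ)) ⊘ evenPS φ) ≈PS timesZ (evenPS y)
  oddQuotient {κ} {φ} {ψ} {y} φ₀≈1 yφ≈κψ = ⊘-unique (≉0-resp-≈ (sym φ₀≈1) 1≉0) λ n →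
    trans (timesZ-⊛ (evenPS y) (evenPS φ) n)
    (trans (timesZ-cong (λ k → trans (evenPS-⊛ y φ k) (trans (evenPS-cong yφ≈κψ k) (sym (evenPS-scale κ ψ k)))) n)
    (sym (timesZ-scale κ (evenPS ψ) n)))

-- The two expansions of the theorem.

module Expansions {c ℓ} (F : Field c ℓ) where
  open Field F
  open OverField F
  open PowerSeries F
  open FieldLemmas F
  open HahnExton F
  open Riccati F
  open IntegerSolver commutativeRing using (solve; _:=_; con; _:*_; _:-_; :-_)
  open import Relation.Binary.Reasoning.Setoid setoid

  module Generic (q t : Carrier)
    (q≉0 : ¬ (q ≈ 0#)) (t≉0 : ¬ (t ≈ 0#))
    (q^k≉1 : ∀ k → ¬ ((1# - pow q (suc k)) ≈ 0#))
    (q^kt≉1 : ∀ k → ¬ ((1# - pow q (suc k) * t) ≈ 0#))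
    where
    open Recursion.Numerators F q t q^k≉1 q^kt≉1

    u : Carrier
    u = 1# - q

    module BaseQ (s h : Carrier) (s²≈q : s * s ≈ q) where

      φ ψ E : PS
      φ = phi (q * t) q u
      ψ = phi (q * q * t) q (s * u)
      E = scaledRatio q

      qtq^k≉1 : ∀ n → ¬ (1# - q * t * pow q n ≈ 0#)
      qtq^k≉1 n = ≉0-resp-≈ (solve 3 (λ q t Q → con (+ 1) :- q :* Q :* t := con (+ 1) :- q :* t :* Q) refl q t _) (q^kt≉1 n)

      qqtq^k≉1 : ∀ n → ¬ (1# - q * q * t * pow q n ≈ 0#)
      qqtq^k≉1 n = ≉0-resp-≈ (solve 3 (λ q t Q → con (+ 1) :- q :* (q :* Q) :* t := con (+ 1) :- q :* q :* t :* Q) refl q t _) (q^kt≉1 (suc n))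

      1-qt≉0 : ¬ (1# - q * t ≈ 0#)
      1-qt≉0 = ≉0-resp-≈ (+-congˡ (-‿cong (*-identityʳ _))) (qtq^k≉1 0)

      φ-suc : ∀ n → (1# - pow q (suc n)) * (1# - pow q (suc n) * t) * φ (suc n) ≈ - (q * u * u * pow q n * φ n)
      φ-suc n = trans
        (solve 4 (λ q t Q x → (con (+ 1) :- q :* Q) :* (con (+ 1) :- q :* Q :* t) :* x
           := (con (+ 1) :- q :* Q) :* (con (+ 1) :- q :* t :* Q) :* x) refl q t _ _)
        (trans (phi-suc u q^k≉1 qtq^k≉1 n) (-‿cong (*-congʳ (*-comm _ _))))

      -- In series form, (1 - q t)(φ_q - φ) = q (1 - q)² v ψ. Both sides have the same first-order
      -- recurrence and the same initial value.
      shift : ∀ n → - ((1# - q * t) * ((1# - pow q (suc n)) * φ (suc n))) ≈ q * u * u * ψ n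
      shift = firstOrderUnique
        (λ n → *-≉0 (q^k≉1 n) (qqtq^k≉1 n))
        step
        (λ n → trans (solve 3 (λ l k x → l :* (k :* x) := k :* (l :* x)) refl _ _ _)
           (trans (*-congˡ (phi-suc (s * u) q^k≉1 qqtq^k≉1 n))
           (solve 3 (λ k x m → k :* (:- (m :* x)) := :- m :* (k :* x)) refl _ _ _)))
        base
        where
        base : - ((1# - q * t) * ((1# - q * 1#) * φ 1)) ≈ q * u * u * ψ 0
        base = begin
          - ((1# - q * t) * ((1# - q * 1#) * φ 1))
            ≈⟨ solve 3 (λ q t x → :- ((con (+ 1) :- q :* t) :* ((con (+ 1) :- q :* con (+ 1)) :* x))
                 := :- ((con (+ 1) :- q :* con (+ 1)) :* (con (+ 1) :- q :* con (+ 1) :* t) :* x)) refl q t _ ⟩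
          - ((1# - q * 1#) * (1# - q * 1# * t) * φ 1)
            ≈⟨ -‿cong (φ-suc 0) ⟩
          - - (q * u * u * 1# * φ 0)
            ≈⟨ solve 2 (λ k x → :- (:- (k :* con (+ 1) :* x)) := k :* x) refl _ _ ⟩
          q * u * u * φ 0
            ≈⟨ *-congˡ (trans (phi-zero u q^k≉1 qtq^k≉1) (sym (phi-zero (s * u) q^k≉1 qqtq^k≉1))) ⟩
          q * u * u * ψ 0 ∎
        step : ∀ n → (1# - pow q (suc n)) * (1# - q * q * t * pow q n) * - ((1# - q * t) * ((1# - pow q (suc (suc n))) * φ (suc (suc n))))
          ≈ - (pow q n * (q * (s * u) * (s * u))) * - ((1# - q * t) * ((1# - pow q (suc n)) * φ (suc n)))
        step n = begin
          _ ≈⟨ solve 4 (λ q t Q x → (con (+ 1) :- q :* Q) :* (con (+ 1) :- q :* q :* t :* Q)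
                  :* (:- ((con (+ 1) :- q :* t) :* ((con (+ 1) :- q :* (q :* Q)) :* x)))
                := :- ((con (+ 1) :- q :* Q) :* (con (+ 1) :- q :* t))
                  :* ((con (+ 1) :- q :* (q :* Q)) :* (con (+ 1) :- q :* (q :* Q) :* t) :* x)) refl q t (pow q n) _ ⟩
          _ ≈⟨ *-congˡ (φ-suc (suc n)) ⟩
          - ((1# - pow q (suc n)) * (1# - q * t)) * - (q * u * u * pow q (suc n) * φ (suc n))
            ≈⟨ solve 5 (λ q t Q u x → :- ((con (+ 1) :- q :* Q) :* (con (+ 1) :- q :* t)) :* (:- (q :* u :* u :* (q :* Q) :* x))
                 := :- (Q :* (q :* u :* u :* q)) :* (:- ((con (+ 1) :- q :* t) :* ((con (+ 1) :- q :* Q) :* x)))) refl q t (pow q n) u _ ⟩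
          - (pow q n * (q * u * u * q)) * - ((1# - q * t) * ((1# - pow q (suc n)) * φ (suc n)))
            -- The extra q produced by the index shift in φ is the s² that ψ carries in its argument
            -- s (1 - q).
            ≈⟨ *-congʳ (-‿cong (*-congˡ (trans (*-congˡ (sym s²≈q))
                 (solve 3 (λ q u s → q :* u :* u :* (s :* s) := q :* (s :* u) :* (s :* u)) refl q u s)))) ⟩
          - (pow q n * (q * (s * u) * (s * u))) * - ((1# - q * t) * ((1# - pow q (suc n)) * φ (suc n))) ∎

      quotient : ∀ n → (scalePS h E ⊛ φ) n ≈ q * h * u * (1# - q * t) ⁻¹ * ψ n
      quotient n = *-cancelˡ-≉0 (*-≉0 1-qt≉0 1-q≉0) (begin
        (1# - q * t) * u * (scalePS h E ⊛ φ) n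
          ≈⟨ *-congˡ (⊛-scaleˡ h E φ n) ⟩
        (1# - q * t) * u * (h * (E ⊛ φ) n)
          ≈⟨ solve 4 (λ a u h x → a :* u :* (h :* x) := h :* (a :* (u :* x))) refl _ _ _ _ ⟩
        h * ((1# - q * t) * (u * (E ⊛ φ) n))
          ≈⟨ *-congˡ (*-congˡ (E⊛φ q t (q * u * u) φ E q^kt≉1 φ-suc (scaledRatio-zero q) (scaledRatio-suc q) n)) ⟩
        h * ((1# - q * t) * - ((1# - pow q (suc n)) * φ (suc n)))
          ≈⟨ *-congˡ (trans (solve 2 (λ a b → a :* (:- b) := :- (a :* b)) refl _ _) (shift n)) ⟩
        h * (q * u * u * ψ n)
          ≈⟨ *-identityʳ _ ⟨
        h * (q * u * u * ψ n) * 1#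
          ≈⟨ *-congˡ (inverseʳ _ 1-qt≉0) ⟨
        h * (q * u * u * ψ n) * ((1# - q * t) * (1# - q * t) ⁻¹)
          ≈⟨ solve 6 (λ h q u x a i → h :* (q :* u :* u :* x) :* (a :* i) := a :* u :* (q :* h :* u :* i :* x)) refl _ _ _ _ _ _ ⟩
        (1# - q * t) * u * (q * h * u * (1# - q * t) ⁻¹ * ψ n) ∎)

      expansion : JRatio q t s h ≈PS scalePS h (oddPS (λ n → N n * D n ⁻¹ * pow q n))
      expansion n = begin
        JRatio q t s h n
          ≈⟨ oddQuotient {y = scalePS h E} (phi-zero u q^k≉1 qtq^k≉1) quotient n ⟩
        timesZ (evenPS (scalePS h E)) n
          ≈⟨ timesZ-cong (evenPS-scale h E) n ⟨
        timesZ (scalePS h (evenPS E)) n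
          ≈⟨ timesZ-scale h (evenPS E) n ⟨
        h * timesZ (evenPS E) n
          ≈⟨ *-congˡ (oddPS-tail _ n) ⟨
        scalePS h (oddPS (λ n → N n * D n ⁻¹ * pow q n)) n ∎

    -- The base q⁻¹.

    module BaseQInverse where

      p a₁ a₂ : Carrier
      p  = q ⁻¹
      a₁ = p * t ⁻¹
      a₂ = p * p * t ⁻¹

      φ ψ E : PS
      φ = phi a₁ p u
      ψ = phi a₂ p u
      E = scaledRatio (q * t)

      qp≈1 : ∀ n → pow q n * pow p n ≈ 1#
      qp≈1 zero    = *-identityˡ 1#
      qp≈1 (suc n) = trans (solve 4 (λ q a p b → q :* a :* (p :* b) := (q :* p) :* (a :* b)) refl _ _ _ _)
        (trans (*-cong (inverseʳ q q≉0) (qp≈1 n)) (*-identityˡ 1#))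

      -- Factors in p = q⁻¹ become factors in q up to a unit. This transfers the nonvanishing
      -- hypotheses to base p and φ to the common recurrence in q.
      clear-p : ∀ n → - pow q (suc n) * (1# - pow p (suc n)) ≈ 1# - pow q (suc n)
      clear-p n = trans (solve 2 (λ a b → :- a :* (con (+ 1) :- b) := a :* b :- a) refl _ _)
        (+-congʳ (qp≈1 (suc n)))

      clear-a₁ : ∀ n → - (pow q (suc n) * t) * (1# - a₁ * pow p n) ≈ 1# - pow q (suc n) * t
      clear-a₁ n = trans (solve 5 (λ a t p i b → :- (a :* t) :* (con (+ 1) :- p :* i :* b) := (a :* (p :* b)) :* (t :* i) :- a :* t) refl _ _ _ _ _)
        (+-congʳ (trans (*-cong (qp≈1 (suc n)) (inverseʳ t t≉0)) (*-identityˡ 1#)))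

      a₂≈a₁p : ∀ n → 1# - a₁ * pow p (suc n) ≈ 1# - a₂ * pow p n
      a₂≈a₁p n = solve 3 (λ p i b → con (+ 1) :- p :* i :* (p :* b) := con (+ 1) :- p :* p :* i :* b) refl p (t ⁻¹) (pow p n)

      p^k≉1 : ∀ n → ¬ (1# - pow p (suc n) ≈ 0#)
      p^k≉1 n = ≉0-factorʳ (≉0-resp-≈ (sym (clear-p n)) (q^k≉1 n))

      a₁p^k≉1 : ∀ n → ¬ (1# - a₁ * pow p n ≈ 0#)
      a₁p^k≉1 n = ≉0-factorʳ (≉0-resp-≈ (sym (clear-a₁ n)) (q^kt≉1 n))

      a₂p^k≉1 : ∀ n → ¬ (1# - a₂ * pow p n ≈ 0#)
      a₂p^k≉1 n = ≉0-resp-≈ (a₂≈a₁p n) (a₁p^k≉1 (suc n))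

      1-a₁≉0 : ¬ (1# - a₁ ≈ 0#)
      1-a₁≉0 = ≉0-resp-≈ (+-congˡ (-‿cong (*-identityʳ _))) (a₁p^k≉1 0)

      φ-rec = phi-suc u p^k≉1 a₁p^k≉1

      -- Passing to q multiplies the recurrence by q^(2n+2) t, of which p^(n+1) cancels half. The
      -- remaining q^(n+1) t is the origin of the factor q t in κ.
      φ-suc : ∀ n → (1# - pow q (suc n)) * (1# - pow q (suc n) * t) * φ (suc n)
        ≈ - (q * t * u * u * pow q n * φ n)
      φ-suc n = begin
        (1# - Q) * (1# - Q * t) * φ (suc n)
          ≈⟨ *-congʳ (*-cong (clear-p n) (clear-a₁ n)) ⟨
        - Q * (1# - pow p (suc n)) * (- (Q * t) * (1# - a₁ * pow p n)) * φ (suc n)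
          ≈⟨ solve 5 (λ Q t a b x → :- Q :* a :* (:- (Q :* t) :* b) :* x := Q :* Q :* t :* (a :* b :* x)) refl _ _ _ _ _ ⟩
        Q * Q * t * ((1# - pow p (suc n)) * (1# - a₁ * pow p n) * φ (suc n))
          ≈⟨ *-congˡ (φ-rec n) ⟩
        Q * Q * t * - (pow p n * (p * u * u) * φ n)
          ≈⟨ solve 6 (λ Q t P p u x → Q :* Q :* t :* (:- (P :* (p :* u :* u) :* x)) := :- (Q :* (p :* P) :* (t :* u :* u :* Q :* x))) refl _ _ _ _ _ _ ⟩
        - (Q * pow p (suc n) * (t * u * u * Q * φ n))
          ≈⟨ -‿cong (trans (*-congʳ (qp≈1 (suc n))) (*-identityˡ _)) ⟩
        - (t * u * u * (q * pow q n) * φ n)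
          ≈⟨ solve 5 (λ t u q Q x → :- (t :* u :* u :* (q :* Q) :* x) := :- (q :* t :* u :* u :* Q :* x)) refl _ _ _ _ _ ⟩
        - (q * t * u * u * pow q n * φ n) ∎
        where Q = pow q (suc n)

      -- Here φ_q dilates by the inverse of the base, so φ_q - φ is a multiple of v ψ with the sign
      -- opposite to that in base q. This is the minus sign of the first expansion.
      shift : ∀ n → (1# - a₁) * ((1# - pow q (suc n)) * φ (suc n)) ≈ u * u * ψ n
      shift = firstOrderUnique
        (λ n → *-≉0 (p^k≉1 n) (a₂p^k≉1 n))
        step
        (λ n → trans (solve 3 (λ l k x → l :* (k :* x) := k :* (l :* x)) refl _ _ _)
           (trans (*-congˡ (phi-suc u p^k≉1 a₂p^k≉1 n))
           (solve 3 (λ k x m → k :* (:- (m :* x)) := :- m :* (k :* x)) refl _ _ _)))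
        base
        where
        base : (1# - a₁) * ((1# - q * 1#) * φ 1) ≈ u * u * ψ 0
        base = begin
          (1# - a₁) * ((1# - q * 1#) * φ 1)
            ≈⟨ *-congˡ (*-congʳ (clear-p 0)) ⟨
          (1# - a₁) * (- (q * 1#) * (1# - p * 1#) * φ 1)
            ≈⟨ solve 4 (λ a q b x → (con (+ 1) :- a) :* (:- (q :* con (+ 1)) :* b :* x)
                 := :- q :* (b :* (con (+ 1) :- a :* con (+ 1)) :* x)) refl _ _ _ _ ⟩
          - q * ((1# - p * 1#) * (1# - a₁ * 1#) * φ 1)
            ≈⟨ *-congˡ (φ-rec 0) ⟩
          - q * - (1# * (p * u * u) * φ 0)
            ≈⟨ solve 4 (λ q p u x → :- q :* (:- (con (+ 1) :* (p :* u :* u) :* x)) := q :* p :* (u :* u :* x)) refl _ _ _ _ ⟩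
          q * p * (u * u * φ 0)
            ≈⟨ trans (*-congʳ (inverseʳ q q≉0)) (*-identityˡ _) ⟩
          u * u * φ 0
            ≈⟨ *-congˡ (trans (phi-zero u p^k≉1 a₁p^k≉1) (sym (phi-zero u p^k≉1 a₂p^k≉1))) ⟩
          u * u * ψ 0 ∎
        step : ∀ n → (1# - pow p (suc n)) * (1# - a₂ * pow p n) * ((1# - a₁) * ((1# - pow q (suc (suc n))) * φ (suc (suc n))))
          ≈ - (pow p n * (p * u * u)) * ((1# - a₁) * ((1# - pow q (suc n)) * φ (suc n)))
        step n = begin
          _ ≈⟨ *-cong (*-congˡ (sym (a₂≈a₁p n))) (*-congˡ (*-congʳ (sym (clear-p (suc n))))) ⟩
          (1# - P₁) * (1# - a₁ * pow p (suc n)) * ((1# - a₁) * (- Q₂ * (1# - pow p (suc (suc n))) * φ (suc (suc n))))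
            ≈⟨ solve 6 (λ a b c Q d x → a :* b :* (c :* (:- Q :* d :* x)) := :- (a :* c :* Q) :* (d :* b :* x)) refl _ _ _ _ _ _ ⟩
          - ((1# - P₁) * (1# - a₁) * Q₂) * ((1# - pow p (suc (suc n))) * (1# - a₁ * pow p (suc n)) * φ (suc (suc n)))
            ≈⟨ *-congˡ (φ-rec (suc n)) ⟩
          - ((1# - P₁) * (1# - a₁) * Q₂) * - (P₁ * (p * u * u) * φ (suc n))
            ≈⟨ solve 7 (λ a c Q P p u x → :- (a :* c :* Q) :* (:- (P :* (p :* u :* u) :* x)) := Q :* (p :* P) :* (a :* c :* (u :* u) :* x)) refl _ _ _ _ _ _ _ ⟩
          Q₂ * pow p (suc (suc n)) * ((1# - P₁) * (1# - a₁) * (u * u) * φ (suc n))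
            ≈⟨ *-congʳ (trans (qp≈1 (suc (suc n))) (sym (qp≈1 (suc n)))) ⟩
          Q₁ * P₁ * ((1# - P₁) * (1# - a₁) * (u * u) * φ (suc n))
            ≈⟨ solve 7 (λ Q P p a c u x → Q :* (p :* P) :* (a :* c :* (u :* u) :* x)
                 := :- (P :* (p :* u :* u)) :* (c :* (:- Q :* a :* x))) refl Q₁ (pow p n) p _ _ u _ ⟩
          - (pow p n * (p * u * u)) * ((1# - a₁) * (- Q₁ * (1# - P₁) * φ (suc n)))
            ≈⟨ *-congˡ (*-congˡ (*-congʳ (clear-p n))) ⟩
          - (pow p n * (p * u * u)) * ((1# - a₁) * ((1# - Q₁) * φ (suc n))) ∎
          where
          P₁ = pow p (suc n)
          Q₁ = pow q (suc n)
          Q₂ = pow q (suc (suc n))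

      quotient : ∀ n → ((λ k → - E k) ⊛ φ) n ≈ u * (1# - a₁) ⁻¹ * ψ n
      quotient n = *-cancelˡ-≉0 (*-≉0 1-a₁≉0 1-q≉0) (begin
        (1# - a₁) * u * ((λ k → - E k) ⊛ φ) n
          ≈⟨ *-congˡ (trans (⊛-cong {g = φ} (λ k → solve 1 (λ x → :- x := :- con (+ 1) :* x) refl (E k)) (λ _ → refl) n)
               (⊛-scaleˡ (- 1#) E φ n)) ⟩
        (1# - a₁) * u * (- 1# * (E ⊛ φ) n)
          ≈⟨ solve 3 (λ a u x → a :* u :* (:- con (+ 1) :* x) := a :* (:- (u :* x))) refl _ _ _ ⟩
        (1# - a₁) * - (u * (E ⊛ φ) n)
          ≈⟨ *-congˡ (-‿cong (E⊛φ q t (q * t * u * u) φ E q^kt≉1 φ-suc (scaledRatio-zero (q * t)) (scaledRatio-suc (q * t)) n)) ⟩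
        (1# - a₁) * - - ((1# - pow q (suc n)) * φ (suc n))
          ≈⟨ trans (solve 2 (λ a b → a :* (:- (:- b)) := a :* b) refl _ _) (shift n) ⟩
        u * u * ψ n
          ≈⟨ *-identityʳ _ ⟨
        u * u * ψ n * 1#
          ≈⟨ *-congˡ (inverseʳ _ 1-a₁≉0) ⟨
        u * u * ψ n * ((1# - a₁) * (1# - a₁) ⁻¹)
          ≈⟨ solve 4 (λ u x a i → u :* u :* x :* (a :* i) := a :* u :* (u :* i :* x)) refl _ _ _ _ ⟩
        (1# - a₁) * u * (u * (1# - a₁) ⁻¹ * ψ n) ∎)

      expansion : JRatioInv q t ≈PS oddPS (λ n → - (N n * D n ⁻¹ * pow (q * t) n))
      expansion n = trans (oddQuotient {y = λ k → - E k} (phi-zero u p^k≉1 a₁p^k≉1) quotient n)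
        (sym (oddPS-tail _ n))

theorem2p8 : Σ (ℕ → Poly3) λ N →
    (F : Field 0ℓ 0ℓ) →
    let open Field F
        open OverField F
    in (q t : Carrier) →
    ¬ (q ≈ 0#) → ¬ (t ≈ 0#) →
    (∀ k → ¬ ((1# - pow q (suc k)) ≈ 0#)) →
    (∀ k → ¬ ((1# - pow q (suc k) * t) ≈ 0#)) →
    (JRatioInv q t ≈PS
    oddPS (λ n → - (Nnν N q t n * Dnν q t n ⁻¹ * pow (q * t) n)))
    × ((s h : Carrier) → (s * s) ≈ q → (h * h * q) ≈ t →
    JRatio q t s h ≈PS
    scalePS h (oddPS (λ n → Nnν N q t n * Dnν q t n ⁻¹ * pow q n)))
theorem2p8 = numerator , λ F q t q≉0 t≉0 q^k≉1 q^kt≉1 →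
  let open Expansions.Generic F q t q≉0 t≉0 q^k≉1 q^kt≉1
  in BaseQInverse.expansion , λ s h s²≈q _ → BaseQ.expansion s h s²≈q
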